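{- Let $\mathfrak{A}$ be an explicit calculus with upward space $\mathrm{Up}(\mathfrak{A})=(\mathbf{S},\eqslantless)$, and let $\mathfrak{B}$ be an implicit calculus with downward space $\mathrm{Down}(\mathfrak{B})=(\mathbf{S}',\leqslant)$. If $\mathfrak{B}\in\mathbf{S}$ or $\mathfrak{A}\in\mathbf{S}'$, then $\mathbf{S}=\mathbf{S}'$, the posets $\mathrm{Up}(\mathfrak{A})$ and $\mathrm{Down}(\mathfrak{B})$ are isomorphic, and $\mathbf{G}(\mathfrak{C})=\mathbf{G}(\mathfrak{D})$ for all $\mathfrak{C},\mathfrak{D}\in\mathbf{S}$.
   Context: Fix a non-empty finite set $\mathtt{E}$ of edge types and a countably infinite set $\mathtt S$ of sequents (atomic labels). G-sequents are finite graphs with edge relations $\mathcal E_a$ ($a\in\mathtt E$) and vertex labels in $\mathtt S$, written $\Gamma\vdash\Delta$. Let $\overline{\mathtt E}=\{\bar a\mid a\in\mathtt E\}$, $\bar{\bar z}=z$, $\overline{x_1\cdots x_n}=\bar x_n\cdots\bar x_1$. An $\mathtt E$-system is a finite set $\mathbf G$ of production rules $x\longrightarrow t$ ($x\in\mathtt E\cup\overline{\mathtt E}$) with $x\longrightarrow t\in\mathbf G$ iff $\bar x\longrightarrow\bar t\in\mathbf G$; $\mathbf G(a)=\{t\mid a\longrightarrow^*_{\mathbf G}t\}$. For $p=x\longrightarrow t$, $\bar p=\bar x\longrightarrow\bar t$; $(p,\bar p)$ is a production pair; $P(\mathbf G)$ the set of pairs in $\mathbf G$; $\mathbf G(P)$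 the set of rules in pairs of $P$. Rules: initial rules $i(C,R)$ and reachability rules $r(\mathcal C,R)$, governed by constraints (trees whose edges $(w,u)$ are labelled by languages $\mathbf G'(a)$, $\mathbf G'$ a participating $\mathtt E$-system, requiring a path $w\to u$ labelled by a string of $\mathbf G'(a)$, edges traversed forward with $b$ and backward with $\bar b$) and sequent constraints $R$; local rules; expansion rules; Horn rules: for $a\in\mathtt E$, string $s=x_1\cdots x_n$, forward Horn rule with premise $\Gamma,w\mathcal E_s u,w\mathcal E_a u\vdash\Delta$ and conclusion $\Gamma,w\mathcal E_s u\vdash\Delta$, backward with $u\mathcal E_a w$ in place of $w\mathcal E_a u$ ($w\mathcal E_s u$ a chain $w\mathcal E_{x_1}v_1,\dots,v_{n-1}\mathcal E_{x_n}u$, $v\mathcal E_{\bar a}z$ meaning $z\mathcal E_a v$, $w\mathcal E_\varepsilon u$ meaning $w=u$). For a pair with $p=a\longrightarrow s$ (resp. $\bar a\longrightarrow s$), $\mathrm H(p,\bar p)$ is the corresponding forward (resp. backward) Horn rule; $\mathrm H(P)=\bigcup_{(p,\bar p)\in P}\mathrm H(p,\bar p)$. Grammars: $\mathbf G(\rho)$ for initial/reachability $\rho$ is the union of participating $\mathtt E$-systems; $\emptyset$ for local/expansion; $\mathbf G(h_f)=\{a\longrightarrow s,\bar a\longrightarrow\bar s\}$, $\mathbf G(h_b)=\{\bar a\longrightarrow s,a\longrightarrow\bar s\}$; unions for sets. Absorb/fracture: $\rho\oplus\mathbf G$ (resp. $\rho\ominus\mathbf G$) replaces each constraint label $\mathbf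 G'(a)$ by $(\mathbf G'\cup\mathbf G)(a)$ (resp. $(\mathbf G'\setminus\mathbf G)(a)$). An abstract calculus is $\mathfrak A=(\mathcal G^{\mathtt E},\mathfrak R)$ with $\mathfrak R$ a finite set of rules; $\mathrm H(\mathfrak A)$ its Horn rules; $\mathbf G(\mathfrak A)=\mathbf G(\mathfrak R)$; $\mathfrak A\setminus\mathrm R$, $\mathfrak A\cup\mathrm R$ act on rule sets; $\mathfrak A\odot\mathbf G$ ($\odot\in\{\oplus,\ominus\}$) applies $\odot\mathbf G$ to each initial and reachability rule. $\mathfrak A$ is explicit iff every initial and reachability rule $\rho$ satisfies $\rho\ominus\mathbf G(\mathfrak A)=\rho$; implicit iff it has no Horn rules and every initial and reachability rule $\rho$ satisfies $\rho\oplus\mathbf G(\mathfrak A)=\rho$. Dependency graphs: for distinct pairs with $p=x\longrightarrow s$, $p'=y\longrightarrow t$, $(p,\bar p)\sqsubset(p',\bar p')$ iff $s$ or $\bar s$ contains $y$; $\sqsubseteq$ the reflexive-transitive closure; $\mathsf{DG}(\mathbf G)=(P(\mathbf G),\sqsubseteq)$; for Horn rules $\mathsf{DG}(\mathrm H)=(\mathrm H,\sqsubseteq')$ with $h\sqsubseteq'h'$ iff the pair of $h$ is $\sqsubseteq$ that of $h'$. $V'$ is fracturable iff there are no $v\in V'$, $v'\notin V'$ with $v\sqsubseteq v'$; anti-fracturable sets are complements of fracturable ones. Upward space $\mathrm{Up}(\mathfrak A)=(\mathbf S,\eqslantless)$: $\mathfrak A\in\mathbf S$; if $\mathfrak B\in\mathbf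 S$ and $\mathrm H'\subseteq\mathrm H(\mathfrak B)$ is anti-fracturable in $\mathsf{DG}(\mathrm H(\mathfrak B))$, then $(\mathfrak B\oplus\mathbf G(\mathrm H'))\setminus\mathrm H'\in\mathbf S$ and $\mathfrak B\eqslantless(\mathfrak B\oplus\mathbf G(\mathrm H'))\setminus\mathrm H'$. Downward space $\mathrm{Down}(\mathfrak A)=(\mathbf S,\leqslant)$: $\mathfrak A\in\mathbf S$; if $\mathfrak B\in\mathbf S$, $\mathbf G:=\mathbf G(\mathfrak B\setminus\mathrm H(\mathfrak B))$ and $P'\subseteq P(\mathbf G)$ is fracturable in $\mathsf{DG}(\mathbf G)$, then $\mathfrak C=(\mathfrak B\ominus\mathbf G(P'))\cup\mathrm H(P')\in\mathbf S$ and $\mathfrak C\leqslant\mathfrak B$.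
   Formalization: Added assumption: if the explicit calculus A has a Horn rule, then some E-system participates in one of its initial or reachability rules; otherwise the claim fails, e.g. for A consisting of a single Horn rule and B with no rules. -}

module Defs where

open import Level using (0ℓ) renaming (suc to lsuc)
open import Data.Empty using (⊥)
open import Data.Fin using (Fin; zero; suc)
import Data.Fin.Properties as Fin
open import Data.List using (List; []; _∷_; _++_; map; filter; foldr; mapMaybe; concatMap; reverse)
open import Data.List.Properties using (≡-dec; reverse-involutive; map-∘; map-id; map-cong; reverse-map; reverse-++; map-++)
open import Data.List.Membership.Propositional using (_∈_; _∉_)
open import Data.List.Membership.Propositional.Properties using (∈-++⁺ˡ; ∈-++⁺ʳ; ∈-++⁻; ∈-filter⁺; ∈-filter⁻; ∈-map⁺; ∈-map⁻)
import Data.List.Membership.DecPropositional as DecMembership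
import Data.List.Membership.Setoid as SetoidMembership
import Data.List.Membership.Setoid.Properties as SetoidMembershipₚ
import Data.List.Relation.Binary.Subset.Setoid as SetoidSubset
import Data.List.Relation.Binary.Subset.Propositional as Subset
open import Data.List.Relation.Binary.BagAndSetEquality using (_∼[_]_; set)
open import Data.List.Relation.Binary.Pointwise as Pointwise using (Pointwise; []; _∷_)
open import Data.List.Relation.Unary.All as All using (All)
open import Data.List.Relation.Unary.Any as Any using (Any; here; there)
import Data.List.Relation.Unary.Any.Properties as Anyₚ
open import Data.Maybe using (Maybe; just; nothing)
open import Data.Nat using (ℕ; zero; suc)
open import Data.Product using (Σ; ∃; ∃₂; ∃-syntax; Σ-syntax; _×_; _,_; proj₁; proj₂)
open import Data.Product.Properties using () renaming (≡-dec to ×-≡-dec)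
open import Data.Sum using (_⊎_; inj₁; inj₂; [_,_]′)
open import Data.Unit using (⊤; tt)
open import Data.Vec as Vec using (Vec; []; _∷_; lookup)
open import Function using (_∘_; _on_; id)
open import Function.Bundles using (_↔_; _⇔_; mk⇔; module Equivalence)
open import Function.Properties.Inverse using (↔⇒↣)
open import Relation.Binary.Bundles using (Setoid; Poset)
open import Relation.Binary.Core using (Rel)
open import Relation.Binary.Construct.Closure.ReflexiveTransitive using (Star; ε; _◅_)
import Relation.Binary.Construct.On as On
open import Relation.Binary.Definitions using (DecidableEquality)
open import Relation.Binary.PropositionalEquality using (_≡_; _≢_; refl; sym; trans; cong; cong₂; subst; setoid)
open import Relation.Nullary using (¬_; Dec; yes; no; ¬?; contradiction)
open import Relation.Nullary.Decidable using (via-injection; map′)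
open import Relation.Unary using (Pred; _≐_; Decidable)

record Signature : Set₁ where
  field
    E           : Set
    E-size-1    : ℕ
    E-finite    : E ↔ Fin (suc E-size-1)
    S           : Set
    S-countable : S ↔ ℕ

module Calculi (sig : Signature) where

  open Signature sig

  data Letter : Set where
    fwd bwd : E → Letter

  String : Set
  String = List Letter

  barˡ : Letter → Letter
  barˡ (fwd a) = bwd a
  barˡ (bwd a) = fwd a

  barˢ : String → String
  barˢ = reverse ∘ map barˡ

  infix 5 _⟶_

  record Production : Set where
    constructor _⟶_
    field
      lhs : Letter
      rhs : String

  bar : Production → Production
  bar (x ⟶ t) = barˡ x ⟶ barˢ t

  barˡ-involutive : ∀ x → barˡ (barˡ x) ≡ x
  barˡ-involutive (fwd a) = refl
  barˡ-involutive (bwd a) = refl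

  barˢ-involutive : ∀ t → barˢ (barˢ t) ≡ t
  barˢ-involutive t =
    trans (cong reverse (reverse-map barˡ (map barˡ t)))
    (trans (reverse-involutive (map barˡ (map barˡ t)))
    (trans (sym (map-∘ t)) (trans (map-cong barˡ-involutive t) (map-id t))))

  bar-involutive : ∀ p → bar (bar p) ≡ p
  bar-involutive (x ⟶ t) = cong₂ _⟶_ (barˡ-involutive x) (barˢ-involutive t)

  _≟ᴱ_ : DecidableEquality E
  _≟ᴱ_ = via-injection (↔⇒↣ E-finite) Fin._≟_

  _≟ˡ_ : DecidableEquality Letter
  fwd a ≟ˡ fwd b = map′ (cong fwd) (λ { refl → refl }) (a ≟ᴱ b)
  fwd a ≟ˡ bwd b = no λ ()
  bwd a ≟ˡ fwd b = no λ ()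
  bwd a ≟ˡ bwd b = map′ (cong bwd) (λ { refl → refl }) (a ≟ᴱ b)

  _≟ᵖ_ : DecidableEquality Production
  (x ⟶ s) ≟ᵖ (y ⟶ t) with x ≟ˡ y | ≡-dec _≟ˡ_ s t
  ... | yes refl | yes refl = yes refl
  ... | no x≢y   | _        = no λ { refl → x≢y refl }
  ... | yes _    | no s≢t   = no λ { refl → s≢t refl }

  open DecMembership _≟ᵖ_ using (_∈?_)

  -- Finite sets are lists, compared by mutual inclusion throughout.
  record ESystem : Set where
    field
      rules  : List Production
      closed : ∀ {p} → p ∈ rules ⇔ bar p ∈ rules

  open ESystem public

  infix 4 _∈ᴳ_ _∉ᴳ_ _≈ᴳ_

  _∈ᴳ_ _∉ᴳ_ : Production → ESystem → Set
  p ∈ᴳ G = p ∈ rules G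
  p ∉ᴳ G = ¬ (p ∈ᴳ G)

  _≈ᴳ_ : Rel ESystem 0ℓ
  G ≈ᴳ G′ = rules G ∼[ set ] rules G′

  ∅ : ESystem
  ∅ = record { rules = [] ; closed = mk⇔ (λ ()) (λ ()) }

  infixl 6 _∪_ _∖_

  _∪_ : ESystem → ESystem → ESystem
  G ∪ G′ = record
    { rules  = rules G ++ rules G′
    ; closed = mk⇔
        ([ ∈-++⁺ˡ ∘ Equivalence.to (closed G) , ∈-++⁺ʳ (rules G) ∘ Equivalence.to (closed G′) ]′ ∘ ∈-++⁻ (rules G))
        ([ ∈-++⁺ˡ ∘ Equivalence.from (closed G) , ∈-++⁺ʳ (rules G) ∘ Equivalence.from (closed G′) ]′ ∘ ∈-++⁻ (rules G))
    }

  _∖_ : ESystem → ESystem → ESystem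
  G ∖ G′ = record
    { rules  = filter ∉G′? (rules G)
    ; closed = mk⇔
        (λ p∈ → let (∈G , ∉G′) = ∈-filter⁻ ∉G′? p∈ in
          ∈-filter⁺ ∉G′? (Equivalence.to (closed G) ∈G) (∉G′ ∘ Equivalence.from (closed G′)))
        (λ p∈ → let (∈G , ∉G′) = ∈-filter⁻ ∉G′? p∈ in
          ∈-filter⁺ ∉G′? (Equivalence.from (closed G) ∈G) (∉G′ ∘ Equivalence.to (closed G′)))
    }
    where
      ∉G′? : Decidable (_∉ᴳ G′)
      ∉G′? p = ¬? (p ∈? rules G′)

  ⋃ : List ESystem → ESystem
  ⋃ = foldr _∪_ ∅

  ⟦_⟧ : Production → ESystem
  ⟦ p ⟧ = record
    { rules  = p ∷ bar p ∷ []
    ; closed = mk⇔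
        (λ { (here refl) → there (here refl) ; (there (here refl)) → here (bar-involutive p) })
        (λ { (here eq) → there (here (trans (sym (bar-involutive _)) (cong bar eq)))
           ; (there (here eq)) → here (trans (sym (bar-involutive _)) (trans (cong bar eq) (bar-involutive p))) })
    }

  data _⊢_⇒_ (G : ESystem) : String → String → Set where
    rewrite-letter : ∀ u {x t} v → (x ⟶ t) ∈ᴳ G → G ⊢ u ++ x ∷ v ⇒ (u ++ t ++ v)

  _⟨_⟩ : ESystem → E → Pred String 0ℓ
  (G ⟨ a ⟩) t = Star (G ⊢_⇒_) (fwd a ∷ []) t

  Graph : ℕ → Set
  Graph n = List (Fin n × E × Fin n)

  record GSequent : Set where
    constructor _⊢_
    field
      {size} : ℕ
      Γ      : Graph size
      Δ      : Fin size → S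

  edge : ∀ {n} → Fin n → Letter → Fin n → Fin n × E × Fin n
  edge w (fwd a) u = w , a , u
  edge w (bwd a) u = u , a , w

  -- w 𝓔ₛ u
  data Path {n} (Γ : Graph n) : Fin n → String → Fin n → Set where
    []  : ∀ {w} → Path Γ w [] w
    _∷_ : ∀ {w x v s u} → edge w x v ∈ Γ → Path Γ v s u → Path Γ w (x ∷ s) u

  data Orientation : Set where
    away towards : Orientation

  -- Trees on the vertices Fin n, built leaf by leaf.  In attach C i o G a the
  -- new leaf is vertex zero, the vertices of C are shifted by one, and the new
  -- edge, labelled by the language G ⟨ a ⟩, runs from vertex i of C to the leaf
  -- (away) or from the leaf to i (towards).
  data Constraint : ℕ → Set where
    point  : Constraint 1
    attach : ∀ {n} → Constraint n → Fin n → Orientation → ESystem → E → Constraint (suc n)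

  Connected : ∀ {n} → Graph n → ESystem → E → Fin n → Fin n → Set
  Connected Γ G a w u = ∃[ t ] (G ⟨ a ⟩) t × Path Γ w t u

  Satisfies : ∀ {n k} → Graph n → Constraint k → Vec (Fin n) k → Set
  Satisfies Γ point                    ws       = ⊤
  Satisfies Γ (attach C i away G a)    (u ∷ ws) = Connected Γ G a (lookup ws i) u × Satisfies Γ C ws
  Satisfies Γ (attach C i towards G a) (u ∷ ws) = Connected Γ G a u (lookup ws i) × Satisfies Γ C ws

  systemsᶜ : ∀ {n} → Constraint n → List ESystem
  systemsᶜ point              = []
  systemsᶜ (attach C _ _ G _) = G ∷ systemsᶜ C

  relabelᶜ : ∀ {n} → (ESystem → ESystem) → Constraint n → Constraint n
  relabelᶜ f point              = point
  relabelᶜ f (attach C i o G a) = attach (relabelᶜ f C) i o (f G) a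

  -- A constraint imposed on vertices chosen among w₁ , … , wₘ.
  record Placed (m : ℕ) : Set where
    constructor _at_
    field
      {arity}    : ℕ
      constraint : Constraint arity
      vertices   : Vec (Fin m) arity

  open Placed

  relabelᵖ : ∀ {m} → (ESystem → ESystem) → Placed m → Placed m
  relabelᵖ f (C at vs) = relabelᶜ f C at vs

  data HornRule : Set where
    forward backward : E → String → HornRule

  -- In sequent constraints the conclusion's labels come first, followed by the
  -- labels of the k premises.
  data Rule : Set₁ where
    initial   : ∀ {m} → Constraint m → Pred (Vec S m) 0ℓ → Rule
    reach     : ∀ {m k} → List (Placed m) → Pred (Vec (Vec S m) (suc k)) 0ℓ → Rule
    local     : ∀ {k} → Pred (Vec S (suc k)) 0ℓ → Rule
    expansion : Letter → Pred (S × S × S) 0ℓ → Rule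
    horn      : HornRule → Rule

  AgreeOff : ∀ {n m} → Vec (Fin n) m → (Fin n → S) → (Fin n → S) → Set
  AgreeOff ws Δ Δ′ = ∀ v → (∀ i → v ≢ lookup ws i) → Δ v ≡ Δ′ v

  shift : ∀ {n} → Graph n → Graph (suc n)
  shift = map λ (w , a , u) → suc w , a , suc u

  -- Instance ρ Πs Π: the list of premises Πs and the conclusion Π form an
  -- instance of ρ.  In an expansion the fresh vertex u is zero.
  Instance : Rule → List GSequent → GSequent → Set
  Instance (initial C R) Πs (Γ ⊢ Δ) =
    Πs ≡ [] × ∃[ ws ] Satisfies Γ C ws × R (Vec.map Δ ws)
  Instance (reach {m} {k} 𝒞 R) Πs (Γ ⊢ Δ) =
    Σ[ ws ∈ Vec _ m ] Σ[ Δs ∈ Vec _ k ]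
      (∀ i → AgreeOff ws Δ (lookup Δs i))
      × Πs ≡ map (Γ ⊢_) (Vec.toList Δs)
      × All (λ P → Satisfies Γ (constraint P) (Vec.map (lookup ws) (vertices P))) 𝒞
      × R (Vec.map Δ ws ∷ Vec.map (λ Δ′ → Vec.map Δ′ ws) Δs)
  Instance (local {k} R) Πs (Γ ⊢ Δ) =
    Σ[ w ∈ _ ] Σ[ Δs ∈ Vec _ k ]
      (∀ i → AgreeOff (w ∷ []) Δ (lookup Δs i))
      × Πs ≡ map (Γ ⊢_) (Vec.toList Δs)
      × R (Δ w ∷ Vec.map (λ Δ′ → Δ′ w) Δs)
  Instance (expansion x R) Πs (Γ ⊢ Δ) =
    Σ[ w ∈ _ ] Σ[ Δ′ ∈ _ ]
      AgreeOff (w ∷ []) Δ (Δ′ ∘ suc)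
      × Πs ≡ ((edge (suc w) x zero ∷ shift Γ) ⊢ Δ′) ∷ []
      × R (Δ w , Δ′ (suc w) , Δ′ zero)
  Instance (horn (forward a s)) Πs (Γ ⊢ Δ) =
    ∃₂ λ w u → Path Γ w s u × Πs ≡ ((edge w (fwd a) u ∷ Γ) ⊢ Δ) ∷ []
  Instance (horn (backward a s)) Πs (Γ ⊢ Δ) =
    ∃₂ λ w u → Path Γ w s u × Πs ≡ ((edge u (fwd a) w ∷ Γ) ⊢ Δ) ∷ []

  data InitialOrReach : Rule → Set₁ where
    isInitial : ∀ {m C R} → InitialOrReach (initial {m} C R)
    isReach   : ∀ {m k 𝒞 R} → InitialOrReach (reach {m} {k} 𝒞 R)

  -- Exactly one of p, p̄ has its left-hand side in E, so a production pair is
  -- given by a and s, standing for (a ⟶ s , ā ⟶ s̄).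
  ProductionPair : Set
  ProductionPair = E × String

  pairOf : Production → ProductionPair
  pairOf (fwd a ⟶ s) = a , s
  pairOf (bwd a ⟶ s) = a , barˢ s

  firstRule : ProductionPair → Production
  firstRule (a , s) = fwd a ⟶ s

  P : ESystem → List ProductionPair
  P G = map pairOf (rules G)

  Gᴾ : List ProductionPair → ESystem
  Gᴾ = ⋃ ∘ map (⟦_⟧ ∘ firstRule)

  -- Either component of the pair may be used: backward a s̄ is the same rule as
  -- forward a s, see _≈ʰ_.
  hornOf : Production → HornRule
  hornOf (fwd a ⟶ s) = forward a s
  hornOf (bwd a ⟶ s) = backward a s

  Hᴾ : List ProductionPair → List HornRule
  Hᴾ = map (hornOf ∘ firstRule)

  productionOf : HornRule → Production
  productionOf (forward a s)  = fwd a ⟶ s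
  productionOf (backward a s) = bwd a ⟶ s

  pairʰ : HornRule → ProductionPair
  pairʰ = pairOf ∘ productionOf

  Gʰ : List HornRule → ESystem
  Gʰ = ⋃ ∘ map (⟦_⟧ ∘ productionOf)

  participating : Rule → List ESystem
  participating (initial C R) = systemsᶜ C
  participating (reach 𝒞 R)   = concatMap (systemsᶜ ∘ constraint) 𝒞
  participating _             = []

  Gᴿ : Rule → ESystem
  Gᴿ (horn h) = ⟦ productionOf h ⟧
  Gᴿ ρ        = ⋃ (participating ρ)

  relabel : (ESystem → ESystem) → Rule → Rule
  relabel f (initial C R)   = initial (relabelᶜ f C) R
  relabel f (reach 𝒞 R)     = reach (map (relabelᵖ f) 𝒞) R
  relabel f (local R)       = local R
  relabel f (expansion x R) = expansion x R
  relabel f (horn h)        = horn h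

  infixl 6 _⊕ᴿ_ _⊖ᴿ_

  _⊕ᴿ_ _⊖ᴿ_ : Rule → ESystem → Rule
  ρ ⊕ᴿ G = relabel (_∪ G) ρ
  ρ ⊖ᴿ G = relabel (_∖ G) ρ

  infix 4 _≈ʰ_ _≈ᶜ_ _≈ᵖ_ _≈ᴿ_ _≈_

  -- The names w, u in a Horn rule are bound: exchanging them turns
  -- backward a s into forward a s̄ (cf. exchange below), so these are one rule,
  -- and a Horn rule is determined by its production pair.
  _≈ʰ_ : Rel HornRule 0ℓ
  _≈ʰ_ = _≡_ on pairʰ

  data _≈ᶜ_ : ∀ {n} → Constraint n → Constraint n → Set where
    point  : point ≈ᶜ point
    attach : ∀ {n} {C C′ : Constraint n} {i o G G′ a} →
             C ≈ᶜ C′ → G ≈ᴳ G′ → attach C i o G a ≈ᶜ attach C′ i o G′ a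

  data _≈ᵖ_ {m} : Placed m → Placed m → Set where
    _at_ : ∀ {n} {C C′ : Constraint n} → C ≈ᶜ C′ → ∀ vs → (C at vs) ≈ᵖ (C′ at vs)

  -- Labels are compared as pairs of an E-system and an edge type, and
  -- E-systems and sequent constraints extensionally.
  data _≈ᴿ_ : Rule → Rule → Set₁ where
    initial   : ∀ {m} {C C′ : Constraint m} {R R′} → C ≈ᶜ C′ → R ≐ R′ → initial C R ≈ᴿ initial C′ R′
    reach     : ∀ {m k} {𝒞 𝒞′ : List (Placed m)} {R R′ : Pred (Vec (Vec S m) (suc k)) 0ℓ} →
                Pointwise _≈ᵖ_ 𝒞 𝒞′ → R ≐ R′ → reach 𝒞 R ≈ᴿ reach 𝒞′ R′
    local     : ∀ {k} {R R′ : Pred (Vec S (suc k)) 0ℓ} → R ≐ R′ → local R ≈ᴿ local R′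
    expansion : ∀ {x R R′} → R ≐ R′ → expansion x R ≈ᴿ expansion x R′
    horn      : ∀ {h h′} → h ≈ʰ h′ → horn h ≈ᴿ horn h′

  reverse-edge : ∀ {n} (w : Fin n) x u → edge w x u ≡ edge u (barˡ x) w
  reverse-edge w (fwd a) u = refl
  reverse-edge w (bwd a) u = refl

  _∷ʳᵖ_ : ∀ {n} {Γ : Graph n} {w s v x u} → Path Γ w s v → edge v x u ∈ Γ → Path Γ w (s ++ x ∷ []) u
  []      ∷ʳᵖ e = e ∷ []
  (d ∷ p) ∷ʳᵖ e = d ∷ (p ∷ʳᵖ e)

  reverse-path : ∀ {n} {Γ : Graph n} {w s u} → Path Γ w s u → Path Γ u (barˢ s) w
  reverse-path [] = []
  reverse-path {Γ = Γ} {w} {u = u} (_∷_ {x = x} {v} {s} e p) =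
    subst (λ t → Path Γ u t w) (sym (reverse-++ (barˡ x ∷ []) (map barˡ s)))
      (reverse-path p ∷ʳᵖ subst (_∈ Γ) (reverse-edge w x v) e)

  exchange : ∀ {a s Πs Π} →
    Instance (horn (backward a s)) Πs Π ⇔ Instance (horn (forward a (barˢ s))) Πs Π
  exchange {s = s} {Π = Γ ⊢ _} = mk⇔
    (λ (w , u , p , eq) → u , w , reverse-path p , eq)
    (λ (w , u , p , eq) → u , w , subst (λ t → Path Γ u t w) (barˢ-involutive s) (reverse-path p) , eq)

  ≈ᴳ-refl : ∀ {G} → G ≈ᴳ G
  ≈ᴳ-refl = mk⇔ id id

  ≈ᴳ-sym : ∀ {G G′} → G ≈ᴳ G′ → G′ ≈ᴳ G
  ≈ᴳ-sym e = mk⇔ (Equivalence.from e) (Equivalence.to e)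

  ≈ᴳ-trans : ∀ {G G′ G″} → G ≈ᴳ G′ → G′ ≈ᴳ G″ → G ≈ᴳ G″
  ≈ᴳ-trans e e′ = mk⇔ (Equivalence.to e′ ∘ Equivalence.to e) (Equivalence.from e ∘ Equivalence.from e′)

  ≈ᶜ-refl : ∀ {n} {C : Constraint n} → C ≈ᶜ C
  ≈ᶜ-refl {C = point}            = point
  ≈ᶜ-refl {C = attach C _ _ G _} = attach ≈ᶜ-refl (≈ᴳ-refl {G})

  ≈ᶜ-sym : ∀ {n} {C C′ : Constraint n} → C ≈ᶜ C′ → C′ ≈ᶜ C
  ≈ᶜ-sym point = point
  ≈ᶜ-sym (attach {G = G} {G′} c g) = attach (≈ᶜ-sym c) (≈ᴳ-sym {G} {G′} g)

  ≈ᶜ-trans : ∀ {n} {C C′ C″ : Constraint n} → C ≈ᶜ C′ → C′ ≈ᶜ C″ → C ≈ᶜ C″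
  ≈ᶜ-trans point point = point
  ≈ᶜ-trans (attach {G = G} {G′} c g) (attach {G′ = G″} c′ g′) =
    attach (≈ᶜ-trans c c′) (≈ᴳ-trans {G} {G′} {G″} g g′)

  ≈ᵖ-refl : ∀ {m} {Q : Placed m} → Q ≈ᵖ Q
  ≈ᵖ-refl = ≈ᶜ-refl at _

  ≈ᵖ-sym : ∀ {m} {Q Q′ : Placed m} → Q ≈ᵖ Q′ → Q′ ≈ᵖ Q
  ≈ᵖ-sym (c at vs) = ≈ᶜ-sym c at vs

  ≈ᵖ-trans : ∀ {m} {Q Q′ Q″ : Placed m} → Q ≈ᵖ Q′ → Q′ ≈ᵖ Q″ → Q ≈ᵖ Q″
  ≈ᵖ-trans (c at vs) (c′ at .vs) = ≈ᶜ-trans c c′ at vs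

  ≈ᴿ-refl : ∀ {ρ} → ρ ≈ᴿ ρ
  ≈ᴿ-refl {initial C R}   = initial ≈ᶜ-refl (id , id)
  ≈ᴿ-refl {reach 𝒞 R}     = reach (Pointwise.refl ≈ᵖ-refl) (id , id)
  ≈ᴿ-refl {local R}       = local (id , id)
  ≈ᴿ-refl {expansion x R} = expansion (id , id)
  ≈ᴿ-refl {horn h}        = horn refl

  ≈ᴿ-sym : ∀ {ρ σ} → ρ ≈ᴿ σ → σ ≈ᴿ ρ
  ≈ᴿ-sym (initial c (f , g)) = initial (≈ᶜ-sym c) (g , f)
  ≈ᴿ-sym (reach c (f , g))   = reach (Pointwise.symmetric ≈ᵖ-sym c) (g , f)
  ≈ᴿ-sym (local (f , g))     = local (g , f)
  ≈ᴿ-sym (expansion (f , g)) = expansion (g , f)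
  ≈ᴿ-sym (horn e)            = horn (sym e)

  ≈ᴿ-trans : ∀ {ρ σ τ} → ρ ≈ᴿ σ → σ ≈ᴿ τ → ρ ≈ᴿ τ
  ≈ᴿ-trans (initial c (f , g)) (initial c′ (f′ , g′)) = initial (≈ᶜ-trans c c′) (f′ ∘ f , g ∘ g′)
  ≈ᴿ-trans (reach c (f , g))   (reach c′ (f′ , g′))   = reach (Pointwise.transitive ≈ᵖ-trans c c′) (f′ ∘ f , g ∘ g′)
  ≈ᴿ-trans (local (f , g))     (local (f′ , g′))      = local (f′ ∘ f , g ∘ g′)
  ≈ᴿ-trans (expansion (f , g)) (expansion (f′ , g′))  = expansion (f′ ∘ f , g ∘ g′)
  ≈ᴿ-trans (horn e)            (horn e′)              = horn (trans e e′)

  hornSetoid : Setoid 0ℓ 0ℓ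
  hornSetoid = On.setoid (setoid ProductionPair) pairʰ

  ruleSetoid : Setoid (lsuc 0ℓ) (lsuc 0ℓ)
  ruleSetoid = record
    { Carrier = Rule
    ; _≈_ = _≈ᴿ_
    ; isEquivalence = record { refl = ≈ᴿ-refl ; sym = ≈ᴿ-sym ; trans = ≈ᴿ-trans }
    }

  open SetoidMembership hornSetoid public using () renaming (_∈_ to _∈ʰ_; _∉_ to _∉ʰ_)
  open SetoidSubset hornSetoid public using () renaming (_⊆_ to _⊆ʰ_)
  open SetoidMembership ruleSetoid public using () renaming (_∈_ to _∈ᴿ_; _∉_ to _∉ᴿ_)
  open SetoidSubset ruleSetoid public using () renaming (_⊆_ to _⊆ᴿ_)

  -- The set of g-sequents is fixed by the signature, so a calculus is given by
  -- its finite set of rules.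
  Calculus : Set₁
  Calculus = List Rule

  _≈_ : Rel Calculus (lsuc 0ℓ)
  A ≈ B = A ⊆ᴿ B × B ⊆ᴿ A

  asHorn : Rule → Maybe HornRule
  asHorn (horn h) = just h
  asHorn _        = nothing

  H : Calculus → List HornRule
  H = mapMaybe asHorn

  G : Calculus → ESystem
  G = ⋃ ∘ map Gᴿ

  infixl 6 _⊕_ _⊖_ _without_ _with′_

  _⊕_ _⊖_ : Calculus → ESystem → Calculus
  A ⊕ X = map (_⊕ᴿ X) A
  A ⊖ X = map (_⊖ᴿ X) A

  OneOf : List HornRule → Pred Rule 0ℓ
  OneOf Hs (horn h) = h ∈ʰ Hs
  OneOf Hs _        = ⊥

  oneOf? : ∀ Hs → Decidable (OneOf Hs)
  oneOf? Hs (initial _ _)   = no λ ()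
  oneOf? Hs (reach _ _)     = no λ ()
  oneOf? Hs (local _)       = no λ ()
  oneOf? Hs (expansion _ _) = no λ ()
  oneOf? Hs (horn h)        = Any.any? (λ h′ → ×-≡-dec _≟ᴱ_ (≡-dec _≟ˡ_) (pairʰ h) (pairʰ h′)) Hs

  _without_ _with′_ : Calculus → List HornRule → Calculus
  A without Hs = filter (¬? ∘ oneOf? Hs) A
  A with′ Hs   = A ++ map horn Hs

  Explicit : Pred Calculus (lsuc 0ℓ)
  Explicit A = All (λ ρ → InitialOrReach ρ → ρ ⊖ᴿ G A ≈ᴿ ρ) A

  Implicit : Pred Calculus (lsuc 0ℓ)
  Implicit A = H A ≡ [] × All (λ ρ → InitialOrReach ρ → ρ ⊕ᴿ G A ≈ᴿ ρ) A

  -- A rule that absorbs an E-system records it only on the edges of its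
  -- constraints.  If no initial or reachability rule of A has such an edge, then
  -- removing a Horn rule loses its grammar for good: with A = {h} explicit and
  -- B = {} implicit, B lies in the upward space of A, yet the downward space of B
  -- is {B} and G A differs from G B.  AbsorbsHorn excludes just this case.
  AbsorbsHorn : Pred Calculus (lsuc 0ℓ)
  AbsorbsHorn A = H A ≢ [] → Any (λ ρ → participating ρ ≢ []) A

  _⊏_ : Rel ProductionPair 0ℓ
  (a , s) ⊏ (b , t) = (a , s) ≢ (b , t) × (fwd b ∈ s ⊎ fwd b ∈ barˢ s)

  _⊑[_]_ : ProductionPair → ESystem → ProductionPair → Set
  p ⊑[ X ] q = Star (λ p q → p ∈ P X × q ∈ P X × p ⊏ q) p q

  record DependencyGraph : Set₁ where
    field
      {Node} : Set
      Vertex : Pred Node 0ℓ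
      _⊑_    : Rel Node 0ℓ

  DG : ESystem → DependencyGraph
  DG X = record { Vertex = _∈ P X ; _⊑_ = _⊑[ X ]_ }

  DGʰ : List HornRule → DependencyGraph
  DGʰ Hs = record { Vertex = _∈ʰ Hs ; _⊑_ = _⊑[ Gʰ Hs ]_ on pairʰ }

  module _ (D : DependencyGraph) where
    open DependencyGraph D

    Fracturable AntiFracturable : Pred Node 0ℓ → Set
    Fracturable V′ = ¬ (∃₂ λ v v′ → Vertex v × Vertex v′ × V′ v × ¬ V′ v′ × v ⊑ v′)
    AntiFracturable V′ = Fracturable (λ v → Vertex v × ¬ V′ v)

  infix 4 _⋜_ _⩽_

  _⋜_ : Rel Calculus (lsuc 0ℓ)
  B ⋜ C = Σ[ H′ ∈ List HornRule ]
    H′ ⊆ʰ H B × AntiFracturable (DGʰ (H B)) (_∈ʰ H′) × C ≈ (B ⊕ Gʰ H′) without H′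

  _⩽_ : Rel Calculus (lsuc 0ℓ)
  C ⩽ B = Σ[ P′ ∈ List ProductionPair ]
    P′ Subset.⊆ P X × Fracturable (DG X) (_∈ P′) × C ≈ (B ⊖ Gᴾ P′) with′ Hᴾ P′
    where X = G (B without H B)

  data UpSpace (A : Calculus) : Pred Calculus (lsuc 0ℓ) where
    start : ∀ {B} → B ≈ A → UpSpace A B
    step  : ∀ {B C} → UpSpace A B → B ⋜ C → UpSpace A C

  data DownSpace (A : Calculus) : Pred Calculus (lsuc 0ℓ) where
    start : ∀ {B} → B ≈ A → DownSpace A B
    step  : ∀ {B C} → DownSpace A B → C ⩽ B → DownSpace A C

  module ⇔ = Equivalence

  ∈-⋃⁻ : ∀ {a} {A : Set a} (f : A → ESystem) xs {p} → p ∈ᴳ ⋃ (map f xs) → Any (λ x → p ∈ᴳ f x) xs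
  ∈-⋃⁻ f (x ∷ xs) p∈ with ∈-++⁻ (rules (f x)) p∈
  ... | inj₁ p∈x  = here p∈x
  ... | inj₂ p∈xs = there (∈-⋃⁻ f xs p∈xs)

  ∈-⋃⁺ : ∀ {a} {A : Set a} (f : A → ESystem) {xs p} → Any (λ x → p ∈ᴳ f x) xs → p ∈ᴳ ⋃ (map f xs)
  ∈-⋃⁺ f (here p∈x)                = ∈-++⁺ˡ p∈x
  ∈-⋃⁺ f {x ∷ xs} (there p∈xs)     = ∈-++⁺ʳ (rules (f x)) (∈-⋃⁺ f p∈xs)

  ∈-∖⁺ : ∀ X Y {p} → p ∈ᴳ X → p ∉ᴳ Y → p ∈ᴳ X ∖ Y
  ∈-∖⁺ X Y = ∈-filter⁺ (λ p → ¬? (p ∈? rules Y))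

  ∈-∖⁻ : ∀ X Y {p} → p ∈ᴳ X ∖ Y → p ∈ᴳ X × p ∉ᴳ Y
  ∈-∖⁻ X Y = ∈-filter⁻ (λ p → ¬? (p ∈? rules Y)) {xs = rules X}

  ∪-cong : ∀ Y {X X′} → X ≈ᴳ X′ → X ∪ Y ≈ᴳ X′ ∪ Y
  ∪-cong Y {X} {X′} e = mk⇔
    ([ ∈-++⁺ˡ ∘ ⇔.to e , ∈-++⁺ʳ (rules X′) ]′ ∘ ∈-++⁻ (rules X))
    ([ ∈-++⁺ˡ ∘ ⇔.from e , ∈-++⁺ʳ (rules X) ]′ ∘ ∈-++⁻ (rules X′))

  ∖-cong : ∀ Y {X X′} → X ≈ᴳ X′ → X ∖ Y ≈ᴳ X′ ∖ Y
  ∖-cong Y {X} {X′} e = mk⇔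
    (λ p∈ → let (i , n) = ∈-∖⁻ X Y p∈ in ∈-∖⁺ X′ Y (⇔.to e i) n)
    (λ p∈ → let (i , n) = ∈-∖⁻ X′ Y p∈ in ∈-∖⁺ X Y (⇔.from e i) n)

  ∪-identityʳ : ∀ X → X ∪ ∅ ≈ᴳ X
  ∪-identityʳ X = mk⇔ ([ id , (λ ()) ]′ ∘ ∈-++⁻ (rules X)) ∈-++⁺ˡ

  ∖-identityʳ : ∀ X → X ∖ ∅ ≈ᴳ X
  ∖-identityʳ X = mk⇔ (proj₁ ∘ ∈-∖⁻ X ∅) (λ i → ∈-∖⁺ X ∅ i λ ())

  ⋃-++⁻ : ∀ {a} {A : Set a} (f : A → ESystem) xs {ys p} →
          p ∈ᴳ ⋃ (map f (xs ++ ys)) → p ∈ᴳ ⋃ (map f xs) ⊎ p ∈ᴳ ⋃ (map f ys)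
  ⋃-++⁻ f xs p∈ with Anyₚ.++⁻ xs (∈-⋃⁻ f _ p∈)
  ... | inj₁ i = inj₁ (∈-⋃⁺ f i)
  ... | inj₂ i = inj₂ (∈-⋃⁺ f i)

  ⋃-++⁺ˡ : ∀ {a} {A : Set a} (f : A → ESystem) xs {ys p} →
           p ∈ᴳ ⋃ (map f xs) → p ∈ᴳ ⋃ (map f (xs ++ ys))
  ⋃-++⁺ˡ f xs p∈ = ∈-⋃⁺ f (Anyₚ.++⁺ˡ (∈-⋃⁻ f xs p∈))

  ⋃-++⁺ʳ : ∀ {a} {A : Set a} (f : A → ESystem) xs {ys p} →
           p ∈ᴳ ⋃ (map f ys) → p ∈ᴳ ⋃ (map f (xs ++ ys))
  ⋃-++⁺ʳ f xs {ys} p∈ = ∈-⋃⁺ f (Anyₚ.++⁺ʳ xs (∈-⋃⁻ f ys p∈))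

  ∪-++ : ∀ {a} {A : Set a} (f : A → ESystem) X xs ys →
         X ∪ ⋃ (map f xs) ∪ ⋃ (map f ys) ≈ᴳ X ∪ ⋃ (map f (xs ++ ys))
  ∪-++ f X xs ys = mk⇔
    (λ p∈ → [ (λ q∈ → [ ∈-++⁺ˡ , ∈-++⁺ʳ (rules X) ∘ ⋃-++⁺ˡ f xs ]′ (∈-++⁻ (rules X) q∈))
            , ∈-++⁺ʳ (rules X) ∘ ⋃-++⁺ʳ f xs ]′ (∈-++⁻ (rules (X ∪ ⋃ (map f xs))) p∈))
    (λ p∈ → [ ∈-++⁺ˡ ∘ ∈-++⁺ˡ
            , (λ q∈ → [ ∈-++⁺ˡ ∘ ∈-++⁺ʳ (rules X)
                      , ∈-++⁺ʳ (rules (X ∪ ⋃ (map f xs))) ]′ (⋃-++⁻ f xs q∈)) ]′ (∈-++⁻ (rules X) p∈))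

  ∖-++ : ∀ {a} {A : Set a} (f : A → ESystem) X xs ys →
         X ∖ ⋃ (map f xs) ∖ ⋃ (map f ys) ≈ᴳ X ∖ ⋃ (map f (xs ++ ys))
  ∖-++ f X xs ys = mk⇔
    (λ p∈ → let (i , n) = ∈-∖⁻ X₁ X″ p∈ ; (j , m) = ∈-∖⁻ X X′ i in
      ∈-∖⁺ X X‴ j ([ m , n ]′ ∘ ⋃-++⁻ f xs))
    (λ p∈ → let (i , n) = ∈-∖⁻ X X‴ p∈ in
      ∈-∖⁺ X₁ X″ (∈-∖⁺ X X′ i (n ∘ ⋃-++⁺ˡ f xs)) (n ∘ ⋃-++⁺ʳ f xs))
    where
      X′ = ⋃ (map f xs)
      X″ = ⋃ (map f ys)
      X‴ = ⋃ (map f (xs ++ ys))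
      X₁ = X ∖ X′

  relabelᶜ-cong : ∀ {f g : ESystem → ESystem} → (∀ {X Y} → X ≈ᴳ Y → f X ≈ᴳ g Y) →
                  ∀ {n} {C C′ : Constraint n} → C ≈ᶜ C′ → relabelᶜ f C ≈ᶜ relabelᶜ g C′
  relabelᶜ-cong fg point = point
  relabelᶜ-cong fg (attach {G = X} {Y} c e) = attach (relabelᶜ-cong fg c) (fg {X} {Y} e)

  relabelᵖ-cong : ∀ {f g : ESystem → ESystem} → (∀ {X Y} → X ≈ᴳ Y → f X ≈ᴳ g Y) →
                  ∀ {m} {Q Q′ : Placed m} → Q ≈ᵖ Q′ → relabelᵖ f Q ≈ᵖ relabelᵖ g Q′
  relabelᵖ-cong fg (c at vs) = relabelᶜ-cong (λ {X} {Y} → fg {X} {Y}) c at vs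

  relabel-cong : ∀ {f g : ESystem → ESystem} → (∀ {X Y} → X ≈ᴳ Y → f X ≈ᴳ g Y) →
                 ∀ {ρ σ} → ρ ≈ᴿ σ → relabel f ρ ≈ᴿ relabel g σ
  relabel-cong {f} {g} fg (initial c r) = initial (relabelᶜ-cong (λ {X} {Y} → fg {X} {Y}) c) r
  relabel-cong {f} {g} fg (reach c r)   = reach (go c) r
    where
      go : ∀ {m} {𝒞 𝒞′ : List (Placed m)} → Pointwise _≈ᵖ_ 𝒞 𝒞′ → Pointwise _≈ᵖ_ (map (relabelᵖ f) 𝒞) (map (relabelᵖ g) 𝒞′)
      go []       = []
      go (q ∷ qs) = relabelᵖ-cong (λ {X} {Y} → fg {X} {Y}) q ∷ go qs
  relabel-cong fg (local r)     = local r
  relabel-cong fg (expansion r) = expansion r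
  relabel-cong fg (horn e)      = horn e

  relabelᶜ-∘ : ∀ f g {n} (C : Constraint n) → relabelᶜ f (relabelᶜ g C) ≡ relabelᶜ (f ∘ g) C
  relabelᶜ-∘ f g point              = refl
  relabelᶜ-∘ f g (attach C i o X a) = cong (λ D → attach D i o (f (g X)) a) (relabelᶜ-∘ f g C)

  relabel-∘ : ∀ f g ρ → relabel f (relabel g ρ) ≡ relabel (f ∘ g) ρ
  relabel-∘ f g (initial C R)   = cong (λ D → initial D R) (relabelᶜ-∘ f g C)
  relabel-∘ f g (reach 𝒞 R)     = cong (λ 𝒟 → reach 𝒟 R)
    (trans (sym (map-∘ 𝒞)) (map-cong (λ (C at vs) → cong (_at vs) (relabelᶜ-∘ f g C)) 𝒞))
  relabel-∘ f g (local R)       = refl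
  relabel-∘ f g (expansion x R) = refl
  relabel-∘ f g (horn h)        = refl

  relabelᶜ-id : ∀ {n} (C : Constraint n) → relabelᶜ id C ≡ C
  relabelᶜ-id point              = refl
  relabelᶜ-id (attach C i o X a) = cong (λ D → attach D i o X a) (relabelᶜ-id C)

  relabel-id : ∀ ρ → relabel id ρ ≡ ρ
  relabel-id (initial C R)   = cong (λ D → initial D R) (relabelᶜ-id C)
  relabel-id (reach 𝒞 R)     = cong (λ 𝒟 → reach 𝒟 R)
    (trans (map-cong (λ (C at vs) → cong (_at vs) (relabelᶜ-id C)) 𝒞) (map-id 𝒞))
  relabel-id (local R)       = refl
  relabel-id (expansion x R) = refl
  relabel-id (horn h)        = refl

  ≡⇒≈ᴿ : ∀ {ρ σ} → ρ ≡ σ → ρ ≈ᴿ σ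
  ≡⇒≈ᴿ refl = ≈ᴿ-refl

  relabel-neutral : ∀ {f} → (∀ X → f X ≈ᴳ X) → ∀ {ρ} → relabel f ρ ≈ᴿ ρ
  relabel-neutral {f} e {ρ} = ≈ᴿ-trans
    (relabel-cong (λ {X} {Y} x → ≈ᴳ-trans {f X} {X} {Y} (e X) x) ≈ᴿ-refl) (≡⇒≈ᴿ (relabel-id ρ))

  relabel-compose : ∀ f g k → (∀ {X Y} → X ≈ᴳ Y → f X ≈ᴳ f Y) → (∀ X → f (g X) ≈ᴳ k X) →
                    ∀ {ρ σ τ} → ρ ≈ᴿ relabel f σ → σ ≈ᴿ relabel g τ → ρ ≈ᴿ relabel k τ
  relabel-compose f g k f-cong fg≈k {τ = τ} e e′ =
    ≈ᴿ-trans e (≈ᴿ-trans (relabel-cong {f} {f} (λ {X} {Y} → f-cong {X} {Y}) e′)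
      (≈ᴿ-trans (≡⇒≈ᴿ (relabel-∘ f g τ)) (relabel-pointwise τ)))
    where
      relabelᶜ-pointwise : ∀ {n} (C : Constraint n) → relabelᶜ (f ∘ g) C ≈ᶜ relabelᶜ k C
      relabelᶜ-pointwise point              = point
      relabelᶜ-pointwise (attach C i o X a) = attach (relabelᶜ-pointwise C) (fg≈k X)

      relabelᵖ-pointwise : ∀ {m} (𝒞 : List (Placed m)) → Pointwise _≈ᵖ_ (map (relabelᵖ (f ∘ g)) 𝒞) (map (relabelᵖ k) 𝒞)
      relabelᵖ-pointwise []            = []
      relabelᵖ-pointwise ((C at vs) ∷ 𝒞) = (relabelᶜ-pointwise C at vs) ∷ relabelᵖ-pointwise 𝒞

      relabel-pointwise : ∀ τ → relabel (f ∘ g) τ ≈ᴿ relabel k τ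
      relabel-pointwise (initial C R)   = initial (relabelᶜ-pointwise C) (id , id)
      relabel-pointwise (reach 𝒞 R)     = reach (relabelᵖ-pointwise 𝒞) (id , id)
      relabel-pointwise (local R)       = ≈ᴿ-refl
      relabel-pointwise (expansion x R) = ≈ᴿ-refl
      relabel-pointwise (horn h)        = ≈ᴿ-refl

  ≈-refl : ∀ {A} → A ≈ A
  ≈-refl = id , id

  ≈-sym : ∀ {A B} → A ≈ B → B ≈ A
  ≈-sym (f , g) = g , f

  ≈-trans : ∀ {A B C} → A ≈ B → B ≈ C → A ≈ C
  ≈-trans (f , g) (f′ , g′) = f′ ∘ f , g ∘ g′

  ∈ᴿ-resp : ∀ {A ρ σ} → ρ ≈ᴿ σ → ρ ∈ᴿ A → σ ∈ᴿ A
  ∈ᴿ-resp = SetoidMembershipₚ.∈-resp-≈ ruleSetoid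

  ∈ʰ-resp : ∀ {Hs h k} → h ≈ʰ k → h ∈ʰ Hs → k ∈ʰ Hs
  ∈ʰ-resp {Hs} {h} {k} = SetoidMembershipₚ.∈-resp-≈ hornSetoid {Hs} {h} {k}

  ∈-H⁺ : ∀ {A h} → horn h ∈ᴿ A → h ∈ʰ H A
  ∈-H⁺ {horn _ ∷ A}        (here (horn e)) = here e
  ∈-H⁺ {horn _ ∷ A}        (there i)       = there (∈-H⁺ i)
  ∈-H⁺ {initial _ _ ∷ A}   (there i)       = ∈-H⁺ i
  ∈-H⁺ {reach _ _ ∷ A}     (there i)       = ∈-H⁺ i
  ∈-H⁺ {local _ ∷ A}       (there i)       = ∈-H⁺ i
  ∈-H⁺ {expansion _ _ ∷ A} (there i)       = ∈-H⁺ i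

  ∈-H⁻ : ∀ {A h} → h ∈ʰ H A → horn h ∈ᴿ A
  ∈-H⁻ {horn _ ∷ A}        (here e)  = here (horn e)
  ∈-H⁻ {horn _ ∷ A}        (there i) = there (∈-H⁻ i)
  ∈-H⁻ {initial _ _ ∷ A}   i         = there (∈-H⁻ i)
  ∈-H⁻ {reach _ _ ∷ A}     i         = there (∈-H⁻ i)
  ∈-H⁻ {local _ ∷ A}       i         = there (∈-H⁻ i)
  ∈-H⁻ {expansion _ _ ∷ A} i         = there (∈-H⁻ i)

  OneOf-resp : ∀ Hs {ρ σ} → ρ ≈ᴿ σ → OneOf Hs ρ → OneOf Hs σ
  OneOf-resp Hs (horn {h} {k} e) i = ∈ʰ-resp {Hs} {h} {k} e i

  OneOf-relabel⁺ : ∀ Hs f {ρ} → OneOf Hs ρ → OneOf Hs (relabel f ρ)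
  OneOf-relabel⁺ Hs f {horn h} i = i

  OneOf-relabel⁻ : ∀ Hs f {ρ} → OneOf Hs (relabel f ρ) → OneOf Hs ρ
  OneOf-relabel⁻ Hs f {horn h} i = i

  OneOf-++⁻ : ∀ Hs {Ks ρ} → OneOf (Hs ++ Ks) ρ → OneOf Hs ρ ⊎ OneOf Ks ρ
  OneOf-++⁻ Hs {ρ = horn h} = Anyₚ.++⁻ Hs

  OneOf-++⁺ˡ : ∀ Hs {Ks ρ} → OneOf Hs ρ → OneOf (Hs ++ Ks) ρ
  OneOf-++⁺ˡ Hs {ρ = horn h} = Anyₚ.++⁺ˡ

  OneOf-++⁺ʳ : ∀ Hs {Ks ρ} → OneOf Ks ρ → OneOf (Hs ++ Ks) ρ
  OneOf-++⁺ʳ Hs {ρ = horn h} = Anyₚ.++⁺ʳ Hs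

  OneOf-[] : ∀ {ρ} → ¬ OneOf [] ρ
  OneOf-[] {initial _ _}   ()
  OneOf-[] {reach _ _}     ()
  OneOf-[] {local _}       ()
  OneOf-[] {expansion _ _} ()
  OneOf-[] {horn _}        ()

  ∈-without⁺ : ∀ Hs {A ρ} → ρ ∈ᴿ A → ¬ OneOf Hs ρ → ρ ∈ᴿ A without Hs
  ∈-without⁺ Hs = SetoidMembershipₚ.∈-filter⁺ ruleSetoid (¬? ∘ oneOf? Hs)
    (λ e n → n ∘ OneOf-resp Hs (≈ᴿ-sym e))

  ∈-without⁻ : ∀ Hs {A ρ} → ρ ∈ᴿ A without Hs → ρ ∈ᴿ A × ¬ OneOf Hs ρ
  ∈-without⁻ Hs = SetoidMembershipₚ.∈-filter⁻ ruleSetoid (¬? ∘ oneOf? Hs)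
    (λ e n → n ∘ OneOf-resp Hs (≈ᴿ-sym e))

  ∈-relabel⁺ : ∀ {f} → (∀ {X Y} → X ≈ᴳ Y → f X ≈ᴳ f Y) → ∀ {A ρ} → ρ ∈ᴿ A → relabel f ρ ∈ᴿ map (relabel f) A
  ∈-relabel⁺ c = SetoidMembershipₚ.∈-map⁺ ruleSetoid ruleSetoid (relabel-cong (λ {X} {Y} → c {X} {Y}))

  ∈-relabel⁻ : ∀ {f A ρ} → ρ ∈ᴿ map (relabel f) A → ∃[ σ ] σ ∈ᴿ A × ρ ≈ᴿ relabel f σ
  ∈-relabel⁻ = SetoidMembershipₚ.∈-map⁻ ruleSetoid ruleSetoid

  module _ (B : Calculus) (Hs : List HornRule) where

    ∈-up⁺ : ∀ {ρ σ} → σ ∈ᴿ B → ρ ≈ᴿ σ ⊕ᴿ Gʰ Hs → ¬ OneOf Hs ρ → ρ ∈ᴿ (B ⊕ Gʰ Hs) without Hs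
    ∈-up⁺ i e n = ∈-without⁺ Hs
      (∈ᴿ-resp (≈ᴿ-sym e) (∈-relabel⁺ (λ {X} {Y} → ∪-cong (Gʰ Hs) {X} {Y}) i)) n

    ∈-up⁻ : ∀ {ρ} → ρ ∈ᴿ (B ⊕ Gʰ Hs) without Hs → ∃[ σ ] σ ∈ᴿ B × ρ ≈ᴿ σ ⊕ᴿ Gʰ Hs × ¬ OneOf Hs ρ
    ∈-up⁻ i = let (j , n) = ∈-without⁻ Hs i ; (σ , k , e) = ∈-relabel⁻ j in σ , k , e , n

  module _ (B : Calculus) (Ps : List ProductionPair) where

    ∈-down⁺ˡ : ∀ {ρ σ} → σ ∈ᴿ B → ρ ≈ᴿ σ ⊖ᴿ Gᴾ Ps → ρ ∈ᴿ (B ⊖ Gᴾ Ps) with′ Hᴾ Ps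
    ∈-down⁺ˡ i e = SetoidMembershipₚ.∈-++⁺ˡ ruleSetoid
      (∈ᴿ-resp (≈ᴿ-sym e) (∈-relabel⁺ (λ {X} {Y} → ∖-cong (Gᴾ Ps) {X} {Y}) i))

    ∈-down⁺ʳ : ∀ {ρ q} → q ∈ Ps → ρ ≈ᴿ horn (hornOf (firstRule q)) → ρ ∈ᴿ (B ⊖ Gᴾ Ps) with′ Hᴾ Ps
    ∈-down⁺ʳ i e = SetoidMembershipₚ.∈-++⁺ʳ ruleSetoid (B ⊖ Gᴾ Ps)
      (Anyₚ.map⁺ (Anyₚ.map⁺ (Any.map (λ { refl → e }) i)))

    ∈-down⁻ : ∀ {ρ} → ρ ∈ᴿ (B ⊖ Gᴾ Ps) with′ Hᴾ Ps →
              (∃[ σ ] σ ∈ᴿ B × ρ ≈ᴿ σ ⊖ᴿ Gᴾ Ps) ⊎ (∃[ q ] q ∈ Ps × ρ ≈ᴿ horn (hornOf (firstRule q)))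
    ∈-down⁻ i with SetoidMembershipₚ.∈-++⁻ ruleSetoid (B ⊖ Gᴾ Ps) i
    ... | inj₁ j = inj₁ (∈-relabel⁻ j)
    ... | inj₂ j = inj₂ (SetoidMembership.find (setoid ProductionPair) (Anyₚ.map⁻ (Anyₚ.map⁻ j)))

  pairOf-bar : ∀ p → pairOf (bar p) ≡ pairOf p
  pairOf-bar (fwd a ⟶ s) = cong (a ,_) (barˢ-involutive s)
  pairOf-bar (bwd a ⟶ s) = refl

  ∈-⟦⟧⁻ : ∀ p {p′} → p′ ∈ᴳ ⟦ p ⟧ → pairOf p′ ≡ pairOf p
  ∈-⟦⟧⁻ p (here refl)         = refl
  ∈-⟦⟧⁻ p (there (here refl)) = pairOf-bar p

  ∈-⟦⟧⁺ : ∀ p {p′} → pairOf p′ ≡ pairOf p → p′ ∈ᴳ ⟦ p ⟧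
  ∈-⟦⟧⁺ (fwd a ⟶ s) {fwd _ ⟶ _} refl = here refl
  ∈-⟦⟧⁺ (fwd a ⟶ s) {bwd _ ⟶ t} refl = there (here (cong (bwd a ⟶_) (sym (barˢ-involutive t))))
  ∈-⟦⟧⁺ (bwd a ⟶ s) {fwd _ ⟶ _} refl = there (here refl)
  ∈-⟦⟧⁺ (bwd a ⟶ s) {bwd b ⟶ t} e
    with refl ← cong proj₁ e
    with refl ← trans (sym (barˢ-involutive t)) (trans (cong (barˢ ∘ proj₂) e) (barˢ-involutive s)) = here refl

  ∈-P⁺ : ∀ X {p} → p ∈ᴳ X → pairOf p ∈ P X
  ∈-P⁺ X = ∈-map⁺ pairOf

  ∈-P⁻ : ∀ X p → pairOf p ∈ P X → p ∈ᴳ X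
  ∈-P⁻ X p q∈ with p′ , p′∈ , e ← ∈-map⁻ pairOf q∈ with ∈-⟦⟧⁺ p′ {p} e
  ... | here refl         = p′∈
  ... | there (here refl) = Equivalence.to (closed X) p′∈

  ∈-Gʰ⁺ : ∀ Hs {h} → h ∈ʰ Hs → productionOf h ∈ᴳ Gʰ Hs
  ∈-Gʰ⁺ Hs {h} i = ∈-⋃⁺ (⟦_⟧ ∘ productionOf) (Any.map (λ {k} → ∈-⟦⟧⁺ (productionOf k) {productionOf h}) i)

  ∈-Gʰ⁻ : ∀ Hs {p} → p ∈ᴳ Gʰ Hs → hornOf p ∈ʰ Hs
  ∈-Gʰ⁻ Hs {p} i = Any.map (λ {k} j → trans (pairʰ-hornOf p) (∈-⟦⟧⁻ (productionOf k) j)) (∈-⋃⁻ (⟦_⟧ ∘ productionOf) Hs i)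
    where
      pairʰ-hornOf : ∀ p → pairʰ (hornOf p) ≡ pairOf p
      pairʰ-hornOf (fwd a ⟶ s) = refl
      pairʰ-hornOf (bwd a ⟶ s) = refl

  ∈-PGʰ⁺ : ∀ Hs {h} → h ∈ʰ Hs → pairʰ h ∈ P (Gʰ Hs)
  ∈-PGʰ⁺ Hs {h} i = ∈-P⁺ (Gʰ Hs) (∈-Gʰ⁺ Hs {h} i)

  ∈-PGʰ⁻ : ∀ Hs {q} → q ∈ P (Gʰ Hs) → hornOf (firstRule q) ∈ʰ Hs
  ∈-PGʰ⁻ Hs {q} i = ∈-Gʰ⁻ Hs {firstRule q} (∈-P⁻ (Gʰ Hs) (firstRule q) i)

  ∈-Gᴾ⁺ : ∀ Ps {p} → pairOf p ∈ Ps → p ∈ᴳ Gᴾ Ps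
  ∈-Gᴾ⁺ Ps {p} i = ∈-⋃⁺ (⟦_⟧ ∘ firstRule) (Any.map (λ {q} → ∈-⟦⟧⁺ (firstRule q) {p}) i)

  ∈-Gᴾ⁻ : ∀ Ps {p} → p ∈ᴳ Gᴾ Ps → pairOf p ∈ Ps
  ∈-Gᴾ⁻ Ps {p} i = Any.map (λ {q} → ∈-⟦⟧⁻ (firstRule q)) (∈-⋃⁻ (⟦_⟧ ∘ firstRule) Ps i)

  H-up⁺ : ∀ {B C} Hs → C ≈ (B ⊕ Gʰ Hs) without Hs → ∀ {h} → h ∈ʰ H B → h ∉ʰ Hs → h ∈ʰ H C
  H-up⁺ {B} Hs e {h} i n = ∈-H⁺ (proj₂ e (∈-up⁺ B Hs (∈-H⁻ {B} {h} i) ≈ᴿ-refl n))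

  H-up⁻ : ∀ {B C} Hs → C ≈ (B ⊕ Gʰ Hs) without Hs → ∀ {h} → h ∈ʰ H C → h ∈ʰ H B × h ∉ʰ Hs
  H-up⁻ {B} {C} Hs e {h} i with ∈-up⁻ B Hs (proj₁ e (∈-H⁻ {C} {h} i))
  ... | horn k , j , horn e′ , n = ∈-H⁺ (∈ᴿ-resp (≈ᴿ-sym (horn {h} {k} e′)) j) , n

  ⋜-reflexive : ∀ {B C} → B ≈ C → B ⋜ C
  ⋜-reflexive {B} {C} (B⊆C , C⊆B) = [] , (λ ()) , (λ (_ , _ , _ , v′∈ , _ , n , _) → n (v′∈ , λ ())) ,
    (λ i → ∈-up⁺ B [] (C⊆B i) (≈ᴿ-sym (relabel-neutral ∪-identityʳ)) OneOf-[]) ,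
    (λ i → let (σ , j , e , _) = ∈-up⁻ B [] i in
      ∈ᴿ-resp (≈ᴿ-sym (≈ᴿ-trans e (relabel-neutral ∪-identityʳ))) (B⊆C j))

  ⋜-antisym : ∀ {B C} → B ⋜ C → C ⋜ B → B ≈ C
  ⋜-antisym {B} {C} ([] , _ , _ , C≈) _ =
    (λ i → proj₂ C≈ (∈-up⁺ B [] i (≈ᴿ-sym (relabel-neutral ∪-identityʳ)) OneOf-[])) ,
    (λ i → let (σ , j , e , _) = ∈-up⁻ B [] (proj₁ C≈ i) in
      ∈ᴿ-resp (≈ᴿ-sym (≈ᴿ-trans e (relabel-neutral ∪-identityʳ))) j)
  ⋜-antisym {B} {C} (h ∷ Hs , Hs⊆ , _ , C≈) (Ks , _ , _ , B≈) =
    contradiction (here refl) (proj₂ (H-up⁻ {B} {C} (h ∷ Hs) C≈ {h}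
      (proj₁ (H-up⁻ {C} {B} Ks B≈ {h} (Hs⊆ {h} (here refl))))))

  ⋜-trans : ∀ {B C D} → B ⋜ C → C ⋜ D → B ⋜ D
  ⋜-trans {B} {C} {D} (Hs , Hs⊆ , antiHs , C≈) (Ks , Ks⊆ , antiKs , D≈) =
    Hs ++ Ks , (λ {h} → ⊆H {h}) , anti , to , from
    where
      ⊆H : (Hs ++ Ks) ⊆ʰ H B
      ⊆H {h} i with Anyₚ.++⁻ Hs i
      ... | inj₁ j = Hs⊆ {h} j
      ... | inj₂ j = proj₁ (H-up⁻ {B} {C} Hs C≈ {h} (Ks⊆ {h} j))

      Outside : ProductionPair → Set
      Outside q = let h = hornOf (firstRule q) in h ∈ʰ H B × h ∉ʰ (Hs ++ Ks)

      forwards : ∀ {p q} → p ⊑[ Gʰ (H B) ] q → Outside p → Outside q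
      forwards ε o = o
      forwards (_◅_ {i = p} {j = q} (p∈ , q∈ , p⊏q) path) (vp , p∉) = forwards path (vq , q∉)
        where
          hp = hornOf (firstRule p)
          hq = hornOf (firstRule q)
          vq : hq ∈ʰ H B
          vq = ∈-PGʰ⁻ (H B) q∈
          q∉ : hq ∉ʰ (Hs ++ Ks)
          q∉ i with Anyₚ.++⁻ Hs i
          ... | inj₁ j = antiHs (hp , hq , vp , vq , (vp , p∉ ∘ Anyₚ.++⁺ˡ) , (λ (_ , n) → n j) , (p∈ , q∈ , p⊏q) ◅ ε)
          ... | inj₂ j = antiKs (hp , hq , vp′ , vq′ , (vp′ , p∉ ∘ Anyₚ.++⁺ʳ Hs) , (λ (_ , n) → n j)
                        , (∈-PGʰ⁺ (H C) {hp} vp′ , ∈-PGʰ⁺ (H C) {hq} vq′ , p⊏q) ◅ ε)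
            where
              vp′ : hp ∈ʰ H C
              vp′ = H-up⁺ {B} {C} Hs C≈ {hp} vp (p∉ ∘ Anyₚ.++⁺ˡ)
              vq′ : hq ∈ʰ H C
              vq′ = Ks⊆ {hq} j

      anti : AntiFracturable (DGʰ (H B)) (_∈ʰ (Hs ++ Ks))
      anti (v , v′ , _ , _ , v-out , v′-in , path) = v′-in (forwards path v-out)

      compose : ∀ {ρ σ τ} → ρ ≈ᴿ σ ⊕ᴿ Gʰ Ks → σ ≈ᴿ τ ⊕ᴿ Gʰ Hs → ρ ≈ᴿ τ ⊕ᴿ Gʰ (Hs ++ Ks)
      compose {τ = τ} = relabel-compose (_∪ Gʰ Ks) (_∪ Gʰ Hs) (_∪ Gʰ (Hs ++ Ks))
        (λ {X} {Y} → ∪-cong (Gʰ Ks) {X} {Y})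
        (λ X → ∪-++ (⟦_⟧ ∘ productionOf) X Hs Ks)

      to : D ⊆ᴿ ((B ⊕ Gʰ (Hs ++ Ks)) without (Hs ++ Ks))
      to i =
        let (σ , j , e , ρ∉) = ∈-up⁻ C Ks (proj₁ D≈ i)
            (τ , k , e′ , σ∉) = ∈-up⁻ B Hs (proj₁ C≈ j)
        in ∈-up⁺ B (Hs ++ Ks) k (compose e e′)
             ([ σ∉ ∘ OneOf-relabel⁻ Hs _ ∘ OneOf-resp Hs e , ρ∉ ]′ ∘ OneOf-++⁻ Hs)

      from : ((B ⊕ Gʰ (Hs ++ Ks)) without (Hs ++ Ks)) ⊆ᴿ D
      from i =
        let (τ , k , e , ρ∉) = ∈-up⁻ B (Hs ++ Ks) i
            σ∈ = proj₂ C≈ (∈-up⁺ B Hs k ≈ᴿ-refl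
                   (ρ∉ ∘ OneOf-++⁺ˡ Hs ∘ OneOf-resp Hs (≈ᴿ-sym e) ∘ OneOf-relabel⁺ Hs _ ∘ OneOf-relabel⁻ Hs _))
        in proj₂ D≈ (∈-up⁺ C Ks σ∈ (≈ᴿ-trans e (≈ᴿ-sym (compose ≈ᴿ-refl ≈ᴿ-refl))) (ρ∉ ∘ OneOf-++⁺ʳ Hs))

  NonHorn : Pred Rule 0ℓ
  NonHorn ρ = asHorn ρ ≡ nothing

  NonHorn-resp : ∀ {ρ σ} → ρ ≈ᴿ σ → NonHorn ρ → NonHorn σ
  NonHorn-resp (initial _ _) _ = refl
  NonHorn-resp (reach _ _)   _ = refl
  NonHorn-resp (local _)     _ = refl
  NonHorn-resp (expansion _) _ = refl

  NonHorn-relabel⁺ : ∀ f ρ → NonHorn ρ → NonHorn (relabel f ρ)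
  NonHorn-relabel⁺ f (initial _ _)   _ = refl
  NonHorn-relabel⁺ f (reach _ _)     _ = refl
  NonHorn-relabel⁺ f (local _)       _ = refl
  NonHorn-relabel⁺ f (expansion _ _) _ = refl

  NonHorn-relabel⁻ : ∀ f ρ → NonHorn (relabel f ρ) → NonHorn ρ
  NonHorn-relabel⁻ f (initial _ _)   _ = refl
  NonHorn-relabel⁻ f (reach _ _)     _ = refl
  NonHorn-relabel⁻ f (local _)       _ = refl
  NonHorn-relabel⁻ f (expansion _ _) _ = refl

  NonHorn⇒¬OneOf : ∀ Hs ρ → NonHorn ρ → ¬ OneOf Hs ρ
  NonHorn⇒¬OneOf Hs (horn h) () _

  ¬OneOf⇒NonHorn : ∀ {A} ρ → ρ ∈ᴿ A → ¬ OneOf (H A) ρ → NonHorn ρ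
  ¬OneOf⇒NonHorn (initial _ _)   _ _ = refl
  ¬OneOf⇒NonHorn (reach _ _)     _ _ = refl
  ¬OneOf⇒NonHorn (local _)       _ _ = refl
  ¬OneOf⇒NonHorn (expansion _ _) _ _ = refl
  ¬OneOf⇒NonHorn (horn h)        i n = contradiction (∈-H⁺ i) n

  systemsᶜ-cong : ∀ {n} {C C′ : Constraint n} → C ≈ᶜ C′ → Pointwise _≈ᴳ_ (systemsᶜ C) (systemsᶜ C′)
  systemsᶜ-cong point        = []
  systemsᶜ-cong (attach c e) = e ∷ systemsᶜ-cong c

  participating-cong : ∀ {ρ σ} → ρ ≈ᴿ σ → Pointwise _≈ᴳ_ (participating ρ) (participating σ)
  participating-cong (initial c _) = systemsᶜ-cong c
  participating-cong (reach c _)   = go c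
    where
      go : ∀ {m} {𝒞 𝒞′ : List (Placed m)} → Pointwise _≈ᵖ_ 𝒞 𝒞′ →
           Pointwise _≈ᴳ_ (concatMap (systemsᶜ ∘ constraint) 𝒞) (concatMap (systemsᶜ ∘ constraint) 𝒞′)
      go []              = []
      go ((c at _) ∷ cs) = Pointwise.++⁺ (systemsᶜ-cong c) (go cs)
  participating-cong (local _)     = []
  participating-cong (expansion _) = []
  participating-cong (horn _)      = []

  systemsᶜ-relabel : ∀ f {n} (C : Constraint n) → systemsᶜ (relabelᶜ f C) ≡ map f (systemsᶜ C)
  systemsᶜ-relabel f point              = refl
  systemsᶜ-relabel f (attach C i o X a) = cong (f X ∷_) (systemsᶜ-relabel f C)

  participating-relabel : ∀ f ρ → participating (relabel f ρ) ≡ map f (participating ρ)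
  participating-relabel f (initial C R) = systemsᶜ-relabel f C
  participating-relabel f (reach 𝒞 R)   = go 𝒞
    where
      go : ∀ {m} (𝒞 : List (Placed m)) → concatMap (systemsᶜ ∘ constraint) (map (relabelᵖ f) 𝒞)
                                       ≡ map f (concatMap (systemsᶜ ∘ constraint) 𝒞)
      go []             = refl
      go ((C at _) ∷ 𝒞) = trans (cong₂ _++_ (systemsᶜ-relabel f C) (go 𝒞)) (sym (map-++ f (systemsᶜ C) _))
  participating-relabel f (local R)       = refl
  participating-relabel f (expansion x R) = refl
  participating-relabel f (horn h)        = refl

  ⋃-cong : ∀ {Xs Ys} → Pointwise _≈ᴳ_ Xs Ys → ∀ {p} → p ∈ᴳ ⋃ Xs → p ∈ᴳ ⋃ Ys
  ⋃-cong []                           i = i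
  ⋃-cong {X ∷ _} {Y ∷ _} (e ∷ es) i = [ ∈-++⁺ˡ ∘ ⇔.to e , ∈-++⁺ʳ (rules Y) ∘ ⋃-cong es ]′ (∈-++⁻ (rules X) i)

  ⋃-∖⁺ : ∀ Xs Y {p} → p ∈ᴳ ⋃ Xs → p ∉ᴳ Y → p ∈ᴳ ⋃ (map (_∖ Y) Xs)
  ⋃-∖⁺ (X ∷ Xs) Y i n =
    [ (λ j → ∈-++⁺ˡ (∈-∖⁺ X Y j n)) , (λ j → ∈-++⁺ʳ (rules (X ∖ Y)) (⋃-∖⁺ Xs Y j n)) ]′ (∈-++⁻ (rules X) i)

  ⋃-∖⁻ : ∀ Xs Y {p} → p ∈ᴳ ⋃ (map (_∖ Y) Xs) → p ∈ᴳ ⋃ Xs × p ∉ᴳ Y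
  ⋃-∖⁻ (X ∷ Xs) Y i with ∈-++⁻ (rules (X ∖ Y)) i
  ... | inj₁ j = let (k , n) = ∈-∖⁻ X Y j in ∈-++⁺ˡ k , n
  ... | inj₂ j = let (k , n) = ⋃-∖⁻ Xs Y j in ∈-++⁺ʳ (rules X) k , n

  Gᴿ-NonHorn : ∀ ρ → NonHorn ρ → Gᴿ ρ ≡ ⋃ (participating ρ)
  Gᴿ-NonHorn (initial _ _)   _ = refl
  Gᴿ-NonHorn (reach _ _)     _ = refl
  Gᴿ-NonHorn (local _)       _ = refl
  Gᴿ-NonHorn (expansion _ _) _ = refl

  Gᴿ-cong : ∀ {ρ σ} → ρ ≈ᴿ σ → ∀ {p} → p ∈ᴳ Gᴿ ρ → p ∈ᴳ Gᴿ σ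
  Gᴿ-cong e@(initial _ _)    = ⋃-cong (participating-cong e)
  Gᴿ-cong e@(reach _ _)      = ⋃-cong (participating-cong e)
  Gᴿ-cong e@(local _)        = ⋃-cong (participating-cong e)
  Gᴿ-cong e@(expansion _)    = ⋃-cong (participating-cong e)
  Gᴿ-cong (horn {h} {h′} e) {p} i = ∈-⟦⟧⁺ (productionOf h′) {p} (trans (∈-⟦⟧⁻ (productionOf h) i) e)

  Gᴿ-⊖⁺ : ∀ σ Y → NonHorn σ → ∀ {p} → p ∈ᴳ Gᴿ σ → p ∉ᴳ Y → p ∈ᴳ Gᴿ (σ ⊖ᴿ Y)
  Gᴿ-⊖⁺ σ Y n i p∉
    rewrite Gᴿ-NonHorn (σ ⊖ᴿ Y) (NonHorn-relabel⁺ (_∖ Y) σ n) | participating-relabel (_∖ Y) σ | Gᴿ-NonHorn σ n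
    = ⋃-∖⁺ (participating σ) Y i p∉

  Gᴿ-⊖⁻ : ∀ σ Y → NonHorn σ → ∀ {p} → p ∈ᴳ Gᴿ (σ ⊖ᴿ Y) → p ∈ᴳ Gᴿ σ × p ∉ᴳ Y
  Gᴿ-⊖⁻ σ Y n i
    rewrite Gᴿ-NonHorn (σ ⊖ᴿ Y) (NonHorn-relabel⁺ (_∖ Y) σ n) | participating-relabel (_∖ Y) σ | Gᴿ-NonHorn σ n
    = ⋃-∖⁻ (participating σ) Y i

  ∈-G⁺ : ∀ {A ρ} → ρ ∈ᴿ A → ∀ {p} → p ∈ᴳ Gᴿ ρ → p ∈ᴳ G A
  ∈-G⁺ i p∈ = ∈-⋃⁺ Gᴿ (Any.map (λ e → Gᴿ-cong e p∈) i)

  ∈-G⁻ : ∀ A {p} → p ∈ᴳ G A → ∃[ ρ ] ρ ∈ᴿ A × p ∈ᴳ Gᴿ ρ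
  ∈-G⁻ A p∈ with ρ , ρ∈ , p∈ρ ← SetoidMembership.find (setoid Rule) (∈-⋃⁻ Gᴿ A p∈) =
    ρ , Any.map (λ { refl → ≈ᴿ-refl }) ρ∈ , p∈ρ

  N : Calculus → ESystem
  N B = G (B without H B)

  ∈-N⁺ : ∀ {B ρ} → ρ ∈ᴿ B → NonHorn ρ → ∀ {p} → p ∈ᴳ Gᴿ ρ → p ∈ᴳ N B
  ∈-N⁺ {B} {ρ} i n = ∈-G⁺ (∈-without⁺ (H B) i (NonHorn⇒¬OneOf (H B) ρ n))

  ∈-N⁻ : ∀ B {p} → p ∈ᴳ N B → ∃[ ρ ] ρ ∈ᴿ B × NonHorn ρ × p ∈ᴳ Gᴿ ρ
  ∈-N⁻ B p∈ =
    let (ρ , i , p∈ρ) = ∈-G⁻ (B without H B) p∈ ; (j , n) = ∈-without⁻ (H B) i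
    in ρ , j , ¬OneOf⇒NonHorn ρ j n , p∈ρ

  N-down⁺ : ∀ {B C} Ps → C ≈ (B ⊖ Gᴾ Ps) with′ Hᴾ Ps → ∀ {p} → p ∈ᴳ N B → p ∉ᴳ Gᴾ Ps → p ∈ᴳ N C
  N-down⁺ {B} Ps e p∈ p∉ =
    let (ρ , i , n , p∈ρ) = ∈-N⁻ B p∈
    in ∈-N⁺ (proj₂ e (∈-down⁺ˡ B Ps i ≈ᴿ-refl)) (NonHorn-relabel⁺ _ ρ n) (Gᴿ-⊖⁺ ρ (Gᴾ Ps) n p∈ρ p∉)

  N-down⁻ : ∀ {B C} Ps → C ≈ (B ⊖ Gᴾ Ps) with′ Hᴾ Ps → ∀ {p} → p ∈ᴳ N C → p ∈ᴳ N B × p ∉ᴳ Gᴾ Ps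
  N-down⁻ {B} {C} Ps e p∈ with ρ , i , n , p∈ρ ← ∈-N⁻ C p∈ with ∈-down⁻ B Ps (proj₁ e i)
  ... | inj₂ (q , _ , ρ≈) = contradiction (NonHorn-resp ρ≈ n) λ ()
  ... | inj₁ (σ , j , ρ≈) =
    let nσ = NonHorn-relabel⁻ _ σ (NonHorn-resp ρ≈ n) ; (p∈σ , p∉) = Gᴿ-⊖⁻ σ (Gᴾ Ps) nσ (Gᴿ-cong ρ≈ p∈ρ)
    in ∈-N⁺ j nσ p∈σ , p∉

  PN-down⁺ : ∀ {B C} Ps → C ≈ (B ⊖ Gᴾ Ps) with′ Hᴾ Ps → ∀ {q} → q ∈ P (N B) → q ∉ Ps → q ∈ P (N C)
  PN-down⁺ {B} {C} Ps e {q} q∈ q∉ =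
    ∈-P⁺ (N C) (N-down⁺ {B} {C} Ps e (∈-P⁻ (N B) (firstRule q) q∈) (q∉ ∘ ∈-Gᴾ⁻ Ps {firstRule q}))

  PN-down⁻ : ∀ {B C} Ps → C ≈ (B ⊖ Gᴾ Ps) with′ Hᴾ Ps → ∀ {q} → q ∈ P (N C) → q ∈ P (N B) × q ∉ Ps
  PN-down⁻ {B} {C} Ps e {q} q∈ =
    let (i , n) = N-down⁻ {B} {C} Ps e (∈-P⁻ (N C) (firstRule q) q∈)
    in ∈-P⁺ (N B) i , n ∘ ∈-Gᴾ⁺ Ps {firstRule q}

  down-[] : ∀ B → (B ⊖ Gᴾ []) with′ Hᴾ [] ≈ B
  down-[] B = to , from
    where
      to : ((B ⊖ Gᴾ []) with′ Hᴾ []) ⊆ᴿ B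
      to i with ∈-down⁻ B [] i
      ... | inj₁ (σ , j , e) = ∈ᴿ-resp (≈ᴿ-sym (≈ᴿ-trans e (relabel-neutral ∖-identityʳ))) j
      ... | inj₂ (_ , () , _)
      from : B ⊆ᴿ ((B ⊖ Gᴾ []) with′ Hᴾ [])
      from i = ∈-down⁺ˡ B [] i (≈ᴿ-sym (relabel-neutral ∖-identityʳ))

  ⩽-reflexive : ∀ {C B} → C ≈ B → C ⩽ B
  ⩽-reflexive {C} {B} e = [] , (λ ()) , (λ { (_ , _ , _ , _ , () , _) }) ,
    ≈-trans {C} {B} {(B ⊖ Gᴾ []) with′ Hᴾ []} e (≈-sym {(B ⊖ Gᴾ []) with′ Hᴾ []} {B} (down-[] B))

  ⩽-antisym : ∀ {C B} → C ⩽ B → B ⩽ C → C ≈ B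
  ⩽-antisym {C} {B} ([] , _ , _ , C≈) _ = ≈-trans {C} {(B ⊖ Gᴾ []) with′ Hᴾ []} {B} C≈ (down-[] B)
  ⩽-antisym {C} {B} (q ∷ Ps , Ps⊆ , _ , C≈) (Qs , _ , _ , B≈) =
    contradiction (here refl) (proj₂ (PN-down⁻ {B} {C} (q ∷ Ps) C≈ {q}
      (proj₁ (PN-down⁻ {C} {B} Qs B≈ {q} (Ps⊆ (here refl))))))

  ⩽-trans : ∀ {D C B} → D ⩽ C → C ⩽ B → D ⩽ B
  ⩽-trans {D} {C} {B} (Qs , Qs⊆ , fracQs , D≈) (Ps , Ps⊆ , fracPs , C≈) =
    Ps ++ Qs , ⊆P , frac , to , from
    where
      ⊆P : ∀ {q} → q ∈ Ps ++ Qs → q ∈ P (N B)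
      ⊆P i with ∈-++⁻ Ps i
      ... | inj₁ j = Ps⊆ j
      ... | inj₂ j = proj₁ (PN-down⁻ {B} {C} Ps C≈ (Qs⊆ j))

      forwards : ∀ {p q} → p ⊑[ N B ] q → p ∈ Ps ++ Qs → ¬ ¬ (q ∈ Ps ++ Qs)
      forwards ε i n = n i
      forwards (_◅_ {i = p} {j = q} (p∈ , q∈ , p⊏q) path) i n = q∉ (λ j → forwards path j n)
        where
          q∉ : ¬ ¬ (q ∈ Ps ++ Qs)
          q∉ m with ∈-++⁻ Ps i
          ... | inj₁ j = fracPs (p , q , p∈ , q∈ , j , m ∘ ∈-++⁺ˡ , (p∈ , q∈ , p⊏q) ◅ ε)
          ... | inj₂ j = fracQs (p , q , Qs⊆ j , q∈′ , j , m ∘ ∈-++⁺ʳ Ps , (Qs⊆ j , q∈′ , p⊏q) ◅ ε)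
            where
              q∈′ : q ∈ P (N C)
              q∈′ = PN-down⁺ {B} {C} Ps C≈ q∈ (m ∘ ∈-++⁺ˡ)

      frac : Fracturable (DG (N B)) (_∈ Ps ++ Qs)
      frac (v , v′ , _ , _ , v∈ , v′∉ , path) = forwards path v∈ v′∉

      compose : ∀ {ρ σ τ} → ρ ≈ᴿ σ ⊖ᴿ Gᴾ Qs → σ ≈ᴿ τ ⊖ᴿ Gᴾ Ps → ρ ≈ᴿ τ ⊖ᴿ Gᴾ (Ps ++ Qs)
      compose = relabel-compose (_∖ Gᴾ Qs) (_∖ Gᴾ Ps) (_∖ Gᴾ (Ps ++ Qs))
        (λ {X} {Y} → ∖-cong (Gᴾ Qs) {X} {Y})
        (λ X → ∖-++ (⟦_⟧ ∘ firstRule) X Ps Qs)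

      to : D ⊆ᴿ ((B ⊖ Gᴾ (Ps ++ Qs)) with′ Hᴾ (Ps ++ Qs))
      to i with ∈-down⁻ C Qs (proj₁ D≈ i)
      ... | inj₂ (q , q∈ , e) = ∈-down⁺ʳ B (Ps ++ Qs) (∈-++⁺ʳ Ps q∈) e
      ... | inj₁ (σ , j , e) with ∈-down⁻ B Ps (proj₁ C≈ j)
      ...   | inj₁ (τ , k , e′)  = ∈-down⁺ˡ B (Ps ++ Qs) k (compose e e′)
      ...   | inj₂ (q , q∈ , e′) = ∈-down⁺ʳ B (Ps ++ Qs) (∈-++⁺ˡ q∈)
                (≈ᴿ-trans e (relabel-cong {_∖ Gᴾ Qs} {_∖ Gᴾ Qs} (λ {X} {Y} → ∖-cong (Gᴾ Qs) {X} {Y}) e′))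

      from : ((B ⊖ Gᴾ (Ps ++ Qs)) with′ Hᴾ (Ps ++ Qs)) ⊆ᴿ D
      from i with ∈-down⁻ B (Ps ++ Qs) i
      ... | inj₁ (τ , k , e) = proj₂ D≈ (∈-down⁺ˡ C Qs (proj₂ C≈ (∈-down⁺ˡ B Ps k ≈ᴿ-refl))
              (≈ᴿ-trans e (≈ᴿ-sym (compose ≈ᴿ-refl ≈ᴿ-refl))))
      ... | inj₂ (q , q∈ , e) with ∈-++⁻ Ps q∈
      ...   | inj₁ j = proj₂ D≈ (∈-down⁺ˡ C Qs (proj₂ C≈ (∈-down⁺ʳ B Ps j ≈ᴿ-refl)) e)
      ...   | inj₂ j = proj₂ D≈ (∈-down⁺ʳ C Qs j e)

  Up : Calculus → Poset (lsuc 0ℓ) (lsuc 0ℓ) (lsuc 0ℓ)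
  Up A = record
    { Carrier = ∃ (UpSpace A)
    ; _≈_ = _≈_ on proj₁
    ; _≤_ = _⋜_ on proj₁
    ; isPartialOrder = record
      { isPreorder = record
        { isEquivalence = record
          { refl  = λ {(B , _)} → ≈-refl {B}
          ; sym   = λ {(B , _)} {(C , _)} → ≈-sym {B} {C}
          ; trans = λ {(B , _)} {(C , _)} {(D , _)} → ≈-trans {B} {C} {D}
          }
        ; reflexive = λ {(B , _)} {(C , _)} → ⋜-reflexive {B} {C}
        ; trans     = λ {(B , _)} {(C , _)} {(D , _)} → ⋜-trans {B} {C} {D}
        }
      ; antisym = λ {(B , _)} {(C , _)} → ⋜-antisym {B} {C}
      }
    }

  Down : Calculus → Poset (lsuc 0ℓ) (lsuc 0ℓ) (lsuc 0ℓ)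
  Down A = record
    { Carrier = ∃ (DownSpace A)
    ; _≈_ = _≈_ on proj₁
    ; _≤_ = _⩽_ on proj₁
    ; isPartialOrder = record
      { isPreorder = record
        { isEquivalence = record
          { refl  = λ {(B , _)} → ≈-refl {B}
          ; sym   = λ {(B , _)} {(C , _)} → ≈-sym {B} {C}
          ; trans = λ {(B , _)} {(C , _)} {(D , _)} → ≈-trans {B} {C} {D}
          }
        ; reflexive = λ {(B , _)} {(C , _)} → ⩽-reflexive {B} {C}
        ; trans     = λ {(B , _)} {(C , _)} {(D , _)} → ⩽-trans {B} {C} {D}
        }
      ; antisym = λ {(B , _)} {(C , _)} → ⩽-antisym {B} {C}
      }
    }

{-# OPTIONS --safe #-}
module Submission where

-- An explicit calculus has only empty E-systems on its constraints, and an
-- implicit calculus B has the single E-system G B on all of them.  Hence every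
-- calculus C in either space is determined by the set V of pairs of its Horn
-- rules: it is a fixed Horn-free skeleton all of whose constraint edges carry
-- T ∖ Gᴾ V, where T = G A = G B, together with the Horn rules of V.  The sets V
-- that occur are exactly the subsets of P T closed under ⊏, and both orders are
-- reverse inclusion of these sets.  For T ≠ ∅ the skeleton has a constraint edge
-- (when B ∈ Up A, by AbsorbsHorn A), so T ∖ Gᴾ V can be read off C.

open import Defs
open import Data.Empty using (⊥-elim)
open import Data.List using (List; []; _∷_; _++_; map; filter; concatMap)
open import Data.List.Properties using (≡-dec)
import Data.List.Membership.DecPropositional as DecMembership
open import Data.List.Membership.Propositional using (_∈_; _∉_; find)
open import Data.List.Membership.Propositional.Properties using (∈-++⁺ˡ; ∈-++⁺ʳ; ∈-++⁻; ∈-filter⁺; ∈-filter⁻)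
import Data.List.Membership.Setoid.Properties as SetoidMembershipₚ
open import Data.List.Relation.Binary.Pointwise using (Pointwise; []; _∷_)
open import Data.List.Relation.Binary.Subset.Propositional using (_⊆_)
open import Data.List.Relation.Unary.All as All using (All; []; _∷_)
import Data.List.Relation.Unary.All.Properties as Allₚ
open import Data.List.Relation.Unary.Any as Any using (Any; here; there)
import Data.List.Relation.Unary.Any.Properties as Anyₚ
open import Data.Product using (_×_; _,_; proj₁; proj₂; ∃; ∃-syntax)
open import Data.Product.Properties using () renaming (≡-dec to ×-≡-dec)
open import Data.Sum using (_⊎_; inj₁; inj₂; [_,_]′)
open import Function using (_∘_; id; const)
open import Function.Bundles using (mk⇔)
open import Relation.Binary.Bundles using (Poset)
open import Relation.Binary.Construct.Closure.ReflexiveTransitive using (ε; _◅_)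
open import Relation.Binary.Definitions using (DecidableEquality)
open import Relation.Binary.Morphism.Structures using (IsOrderIsomorphism)
open import Relation.Binary.PropositionalEquality using (_≡_; _≢_; refl; sym; subst)
open import Relation.Nullary using (yes; no; ¬?; contradiction)
open import Relation.Unary using (_≐_)

module _ (sig : Signature) where

  open Calculi sig
  open Signature sig

  -- Finite sets of production pairs, and Horn rules as pairs

  _≟ᵠ_ : DecidableEquality ProductionPair
  _≟ᵠ_ = ×-≡-dec _≟ᴱ_ (≡-dec _≟ˡ_)

  open DecMembership _≟ᵠ_ using (_∈?_)

  infixl 6 _─_

  _─_ : List ProductionPair → List ProductionPair → List ProductionPair
  V ─ W = filter (λ q → ¬? (q ∈? W)) V

  ∈-─⁺ : ∀ V W {q} → q ∈ V → q ∉ W → q ∈ V ─ W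
  ∈-─⁺ V W = ∈-filter⁺ (λ q → ¬? (q ∈? W))

  ∈-─⁻ : ∀ V W {q} → q ∈ V ─ W → q ∈ V × q ∉ W
  ∈-─⁻ V W = ∈-filter⁻ (λ q → ¬? (q ∈? W)) {xs = V}

  -- As `≈ʰ` compares Horn rules by their pairs, `h ∈ʰ Hs` amounts to `pairʰ h ∈ pairs Hs`, so sets
  -- of Horn rules can be handled as sets of pairs.
  pairs : List HornRule → List ProductionPair
  pairs = map pairʰ

  hornᵠ : ProductionPair → HornRule
  hornᵠ = hornOf ∘ firstRule

  -- `pairʰ (hornᵠ q)` computes to `q`, so the two `map`s peel off without any rewriting.
  ∈-pairs-Hᴾ⁺ : ∀ V {q} → q ∈ V → q ∈ pairs (Hᴾ V)
  ∈-pairs-Hᴾ⁺ V = Anyₚ.map⁺ ∘ Anyₚ.map⁺ {f = hornᵠ}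

  ∈-pairs-Hᴾ⁻ : ∀ V {q} → q ∈ pairs (Hᴾ V) → q ∈ V
  ∈-pairs-Hᴾ⁻ V = Anyₚ.map⁻ {f = hornᵠ} ∘ Anyₚ.map⁻

  ∈-Gʰ-pairs⁺ : ∀ Hs {p} → pairOf p ∈ pairs Hs → p ∈ᴳ Gʰ Hs
  ∈-Gʰ-pairs⁺ Hs {p} i = ∈-P⁻ (Gʰ Hs) p (∈-PGʰ⁺ Hs {hornᵠ (pairOf p)} (Anyₚ.map⁻ i))

  ∈-Gʰ-pairs⁻ : ∀ Hs {p} → p ∈ᴳ Gʰ Hs → pairOf p ∈ pairs Hs
  ∈-Gʰ-pairs⁻ Hs i = Anyₚ.map⁺ (∈-PGʰ⁻ Hs (∈-P⁺ (Gʰ Hs) i))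

  -- Relabellings that fix a rule

  relabelᶜ-fixed : ∀ f {n} (C : Constraint n) → All (λ X → f X ≈ᴳ X) (systemsᶜ C) → relabelᶜ f C ≈ᶜ C
  relabelᶜ-fixed f point              _        = point
  relabelᶜ-fixed f (attach C i o X a) (e ∷ es) = attach (relabelᶜ-fixed f C es) e

  relabel-fixed : ∀ f ρ → All (λ X → f X ≈ᴳ X) (participating ρ) → relabel f ρ ≈ᴿ ρ
  relabel-fixed f (initial C R) es = initial (relabelᶜ-fixed f C es) (id , id)
  relabel-fixed f (reach 𝒞 R)   es = reach (go 𝒞 es) (id , id)
    where
      go : ∀ {m} (𝒞 : List (Placed m)) →
           All (λ X → f X ≈ᴳ X) (concatMap (systemsᶜ ∘ Placed.constraint) 𝒞) →
           Pointwise _≈ᵖ_ (map (relabelᵖ f) 𝒞) 𝒞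
      go []             _  = []
      go ((C at vs) ∷ 𝒞) es =
        (relabelᶜ-fixed f C (Allₚ.++⁻ˡ (systemsᶜ C) es) at vs) ∷ go 𝒞 (Allₚ.++⁻ʳ (systemsᶜ C) es)
  relabel-fixed f (local R)       _ = ≈ᴿ-refl
  relabel-fixed f (expansion x R) _ = ≈ᴿ-refl
  relabel-fixed f (horn h)        _ = ≈ᴿ-refl

  -- Listing the labels commutes with relabelling and respects `≈ᴿ`, so the equivalence of rules can
  -- be compared edge by edge.
  relabel-fixed⁻ : ∀ f ρ → relabel f ρ ≈ᴿ ρ → All (λ X → f X ≈ᴳ X) (participating ρ)
  relabel-fixed⁻ f ρ e =
    go (participating ρ) (subst (λ Xs → Pointwise _≈ᴳ_ Xs _) (participating-relabel f ρ) (participating-cong e))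
    where
      go : ∀ Xs → Pointwise _≈ᴳ_ (map f Xs) Xs → All (λ X → f X ≈ᴳ X) Xs
      go []       []       = []
      go (X ∷ Xs) (x ∷ xs) = x ∷ go Xs xs

  -- The grammar of a calculus, split into its Horn-free and its Horn part

  participating⊆N : ∀ {A ρ} → ρ ∈ᴿ A → NonHorn ρ → ∀ {X} → X ∈ participating ρ → ∀ {p} → p ∈ᴳ X → p ∈ᴳ N A
  participating⊆N {A} {ρ} i n {X} X∈ {p} p∈ = ∈-N⁺ i n
    (subst (p ∈ᴳ_) (sym (Gᴿ-NonHorn ρ n)) (go X∈))
    where
      go : ∀ {Xs} → X ∈ Xs → p ∈ᴳ ⋃ Xs
      go (here refl)         = ∈-++⁺ˡ p∈
      go {Y ∷ _} (there j)   = ∈-++⁺ʳ (rules Y) (go j)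

  rule-cases : ∀ ρ → NonHorn ρ ⊎ ∃[ h ] ρ ≡ horn h
  rule-cases (initial _ _)   = inj₁ refl
  rule-cases (reach _ _)     = inj₁ refl
  rule-cases (local _)       = inj₁ refl
  rule-cases (expansion _ _) = inj₁ refl
  rule-cases (horn h)        = inj₂ (h , refl)

  N⊆G : ∀ A {p} → p ∈ᴳ N A → p ∈ᴳ G A
  N⊆G A p∈ = let (ρ , i , _ , p∈ρ) = ∈-N⁻ A p∈ in ∈-G⁺ i p∈ρ

  pairs-H⊆G : ∀ A {p} → pairOf p ∈ pairs (H A) → p ∈ᴳ G A
  pairs-H⊆G A {p} i =
    -- `p` may be the barred half of its pair; the Horn rule is built from the unbarred half, and
    -- `⟦_⟧` contains both.
    ∈-G⁺ {A} {horn h} (∈-H⁻ {A} {h} (Anyₚ.map⁻ i)) (∈-⟦⟧⁺ (firstRule (pairOf p)) {p} refl)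
    where h = hornᵠ (pairOf p)

  G⊆N∪H : ∀ A {p} → p ∈ᴳ G A → p ∈ᴳ N A ⊎ pairOf p ∈ pairs (H A)
  G⊆N∪H A {p} p∈ with ρ , i , p∈ρ ← ∈-G⁻ A p∈ with rule-cases ρ
  ... | inj₁ n          = inj₁ (∈-N⁺ i n p∈ρ)
  ... | inj₂ (h , refl) = inj₂ (subst (_∈ pairs (H A)) (sym (∈-⟦⟧⁻ (productionOf h) p∈ρ)) (Anyₚ.map⁺ (∈-H⁺ i)))

  Coincide : Calculus → Calculus → Set₁
  Coincide A B =
    UpSpace A ≐ DownSpace B
    × ∃ (IsOrderIsomorphism (Poset._≈_ (Up A)) (Poset._≈_ (Down B)) (Poset._≤_ (Up A)) (Poset._≤_ (Down B)))
    × (∀ C D → UpSpace A C → UpSpace A D → G C ≈ᴳ G D)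

  -- Canonical calculi over a fixed Horn-free skeleton

  module Skeleton
    (T : ESystem) (N₀ : Calculus)
    (nonHorn : ∀ {ρ} → ρ ∈ᴿ N₀ → NonHorn ρ)
    (edged : ∀ {p} → p ∈ᴳ T → ∃[ ρ ] ρ ∈ᴿ N₀ × participating ρ ≢ [])
    where

    rest : List ProductionPair → ESystem
    rest V = T ∖ Gᴾ V

    ∈-rest⁺ : ∀ V {p} → p ∈ᴳ T → pairOf p ∉ V → p ∈ᴳ rest V
    ∈-rest⁺ V {p} i n = ∈-∖⁺ T (Gᴾ V) i (n ∘ ∈-Gᴾ⁻ V {p})

    ∈-rest⁻ : ∀ V {p} → p ∈ᴳ rest V → p ∈ᴳ T × pairOf p ∉ V
    ∈-rest⁻ V {p} i = let (j , n) = ∈-∖⁻ T (Gᴾ V) i in j , n ∘ ∈-Gᴾ⁺ V {p}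

    -- The constant relabelling overwrites every label found in `N₀`; only the shapes of its
    -- constraints and its sequent constraints survive. Hence the skeleton may come from either end
    -- of the spaces.
    canon : List ProductionPair → Calculus
    canon V = map (relabel (const (rest V))) N₀ with′ Hᴾ V

    ∈-canon⁺ˡ : ∀ V {ρ σ} → σ ∈ᴿ N₀ → ρ ≈ᴿ relabel (const (rest V)) σ → ρ ∈ᴿ canon V
    ∈-canon⁺ˡ V i e = SetoidMembershipₚ.∈-++⁺ˡ ruleSetoid
      (∈ᴿ-resp (≈ᴿ-sym e) (∈-relabel⁺ {const (rest V)} (λ _ → ≈ᴳ-refl {rest V}) i))

    ∈-canon⁺ʳ : ∀ V {ρ q} → q ∈ V → ρ ≈ᴿ horn (hornᵠ q) → ρ ∈ᴿ canon V
    ∈-canon⁺ʳ V i e = SetoidMembershipₚ.∈-++⁺ʳ ruleSetoid (map (relabel (const (rest V))) N₀)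
      (Anyₚ.map⁺ (Anyₚ.map⁺ (Any.map (λ { refl → e }) i)))

    ∈-canon⁻ : ∀ V {ρ} → ρ ∈ᴿ canon V →
               (∃[ σ ] σ ∈ᴿ N₀ × ρ ≈ᴿ relabel (const (rest V)) σ) ⊎ (∃[ q ] q ∈ V × ρ ≈ᴿ horn (hornᵠ q))
    ∈-canon⁻ V i with SetoidMembershipₚ.∈-++⁻ ruleSetoid (map (relabel (const (rest V))) N₀) i
    ... | inj₁ j = inj₁ (∈-relabel⁻ j)
    ... | inj₂ j = inj₂ (find (Anyₚ.map⁻ (Anyₚ.map⁻ j)))

    -- Any relabelling after a constant one is again constant. Comparing canonical calculi thus
    -- reduces to one equation between E-systems, `f (rest V) ≈ᴳ k`.
    relabel-rest : ∀ f V {k} → (∀ {X Y} → X ≈ᴳ Y → f X ≈ᴳ f Y) → f (rest V) ≈ᴳ k →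
                   ∀ {ρ σ τ} → ρ ≈ᴿ relabel f σ → σ ≈ᴿ relabel (const (rest V)) τ → ρ ≈ᴿ relabel (const k) τ
    relabel-rest f V {k} c e = relabel-compose f (const (rest V)) (const k) (λ {X} {Y} → c {X} {Y}) (λ _ → e)

    canon-cong : ∀ V W → V ⊆ W → W ⊆ V → canon V ≈ canon W
    canon-cong V W V⊆W W⊆V = go V W V⊆W W⊆V , go W V W⊆V V⊆W
      where
        go : ∀ V W → V ⊆ W → W ⊆ V → canon V ⊆ᴿ canon W
        go V W V⊆W W⊆V i with ∈-canon⁻ V i
        ... | inj₂ (q , q∈ , e) = ∈-canon⁺ʳ W (V⊆W q∈) e
        ... | inj₁ (σ , j , e)  = ∈-canon⁺ˡ W j (relabel-rest id V {rest W} id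
          (mk⇔ (λ p∈ → let (i , n) = ∈-rest⁻ V p∈ in ∈-rest⁺ W i (n ∘ W⊆V))
               (λ p∈ → let (i , n) = ∈-rest⁻ W p∈ in ∈-rest⁺ V i (n ∘ V⊆W)))
          (≡⇒≈ᴿ (sym (relabel-id _))) e)

    -- Horn rules and grammar of a canonical calculus, and the effect of a move on it

    module _ {C : Calculus} (V : List ProductionPair) (C≈ : C ≈ canon V) where

      H-canon⁺ : ∀ {q} → q ∈ V → hornᵠ q ∈ʰ H C
      H-canon⁺ {q} i = ∈-H⁺ {C} {hornᵠ q} (proj₂ C≈ (∈-canon⁺ʳ V i ≈ᴿ-refl))

      H-canon⁻ : ∀ {h} → h ∈ʰ H C → pairʰ h ∈ V
      H-canon⁻ {h} i with ∈-canon⁻ V (proj₁ C≈ (∈-H⁻ {C} {h} i))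
      ... | inj₁ (σ , j , e)       = contradiction (NonHorn-resp (≈ᴿ-sym e) (NonHorn-relabel⁺ _ σ (nonHorn j))) λ ()
      ... | inj₂ (q , j , horn e)  = subst (_∈ V) (sym e) j

      -- `edged` supplies an edge of the skeleton, and in `C` that edge is labelled `rest V`.
      N-canon⁺ : ∀ {p} → p ∈ᴳ T → pairOf p ∉ V → p ∈ᴳ N C
      N-canon⁺ {p} p∈ p∉ with edged p∈
      ... | σ , j , ne = participating⊆N {C} {relabel (const (rest V)) σ} (proj₂ C≈ (∈-canon⁺ˡ V j ≈ᴿ-refl))
          (NonHorn-relabel⁺ _ σ (nonHorn j))
          (subst (rest V ∈_) (sym (participating-relabel (const (rest V)) σ)) (go (participating σ) ne))
          (∈-rest⁺ V p∈ p∉)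
        where
          go : ∀ Xs → Xs ≢ [] → rest V ∈ map (const (rest V)) Xs
          go []      n = ⊥-elim (n refl)
          go (_ ∷ _) _ = here refl

      -- All edges carry the same label `rest V`, so a union over edges cannot exceed it.
      N-canon⁻ : ∀ {p} → p ∈ᴳ N C → p ∈ᴳ T × pairOf p ∉ V
      N-canon⁻ {p} p∈ with ρ , i , n , p∈ρ ← ∈-N⁻ C p∈ with ∈-canon⁻ V (proj₁ C≈ i)
      ... | inj₂ (q , j , e) = contradiction (NonHorn-resp e n) λ ()
      ... | inj₁ (σ , j , e) = ∈-rest⁻ V (go (participating σ)
          (subst (p ∈ᴳ_) (Gᴿ-NonHorn _ (NonHorn-resp e n)) (Gᴿ-cong e p∈ρ) ▹ participating-relabel (const (rest V)) σ))
        where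
          _▹_ : ∀ {Xs Ys} → p ∈ᴳ ⋃ Xs → Xs ≡ Ys → p ∈ᴳ ⋃ Ys
          i ▹ refl = i
          go : ∀ Xs → p ∈ᴳ ⋃ (map (const (rest V)) Xs) → p ∈ᴳ rest V
          go Xs i = proj₂ (Any.satisfied (∈-⋃⁻ (const (rest V)) Xs i))

      PN-canon⁺ : ∀ {q} → q ∈ P T → q ∉ V → q ∈ P (N C)
      PN-canon⁺ {q} i n = ∈-P⁺ (N C) (N-canon⁺ (∈-P⁻ T (firstRule q) i) n)

      PN-canon⁻ : ∀ {q} → q ∈ P (N C) → q ∈ P T × q ∉ V
      PN-canon⁻ {q} i = let (j , n) = N-canon⁻ (∈-P⁻ (N C) (firstRule q) i) in ∈-P⁺ T j , n

      -- Each production of `T` is kept either by a Horn rule, when its pair is in `V`, or on the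
      -- edges otherwise. The bound on `V` prevents the Horn rules from contributing anything else.
      G-canon : V ⊆ P T → G C ≈ᴳ T
      G-canon V⊆ = mk⇔ to from
        where
          to : ∀ {p} → p ∈ᴳ G C → p ∈ᴳ T
          to {p} i with G⊆N∪H C i
          ... | inj₁ j = proj₁ (N-canon⁻ j)
          ... | inj₂ j = ∈-P⁻ T p (V⊆ (H-canon⁻ {hornᵠ (pairOf p)} (Anyₚ.map⁻ j)))
          from : ∀ {p} → p ∈ᴳ T → p ∈ᴳ G C
          from {p} i with pairOf p ∈? V
          ... | yes j = pairs-H⊆G C {p} (Anyₚ.map⁺ (H-canon⁺ j))
          ... | no n  = N⊆G C (N-canon⁺ i n)

      -- Taking pairs out of `V` returns their productions to `T ∖ Gᴾ V`. As `Hs` lies within `T`,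
      -- what returns is exactly what `Hs` makes the edges absorb.
      up-canon : ∀ Hs → pairs Hs ⊆ P T → (C ⊕ Gʰ Hs) without Hs ≈ canon (V ─ pairs Hs)
      up-canon Hs Hs⊆ = to , from
        where
          absorbed : rest V ∪ Gʰ Hs ≈ᴳ rest (V ─ pairs Hs)
          absorbed = mk⇔ forth back
            where
              forth : ∀ {p} → p ∈ᴳ rest V ∪ Gʰ Hs → p ∈ᴳ rest (V ─ pairs Hs)
              forth {p} p∈ with ∈-++⁻ (rules (rest V)) p∈
              ... | inj₁ i = let (j , n) = ∈-rest⁻ V i in ∈-rest⁺ (V ─ pairs Hs) j (n ∘ proj₁ ∘ ∈-─⁻ V _)
              ... | inj₂ i = let j = ∈-Gʰ-pairs⁻ Hs {p} i in
                ∈-rest⁺ (V ─ pairs Hs) (∈-P⁻ T p (Hs⊆ j)) (λ k → proj₂ (∈-─⁻ V _ k) j)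

              back : ∀ {p} → p ∈ᴳ rest (V ─ pairs Hs) → p ∈ᴳ rest V ∪ Gʰ Hs
              back {p} i with ∈-rest⁻ (V ─ pairs Hs) i | pairOf p ∈? pairs Hs
              ... | _     | yes k = ∈-++⁺ʳ (rules (rest V)) (∈-Gʰ-pairs⁺ Hs {p} k)
              ... | j , n | no k  = ∈-++⁺ˡ (∈-rest⁺ V j (λ m → n (∈-─⁺ V _ m k)))

          compose : ∀ {ρ σ τ} → ρ ≈ᴿ σ ⊕ᴿ Gʰ Hs → σ ≈ᴿ relabel (const (rest V)) τ →
                    ρ ≈ᴿ relabel (const (rest (V ─ pairs Hs))) τ
          compose = relabel-rest (_∪ Gʰ Hs) V (λ {X} {Y} → ∪-cong (Gʰ Hs) {X} {Y}) absorbed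

          to : ((C ⊕ Gʰ Hs) without Hs) ⊆ᴿ canon (V ─ pairs Hs)
          to i with σ , j , e , n ← ∈-up⁻ C Hs i with ∈-canon⁻ V (proj₁ C≈ j)
          ... | inj₁ (τ , k , e′)  = ∈-canon⁺ˡ (V ─ pairs Hs) k (compose e e′)
          ... | inj₂ (q , q∈ , e′) =
            -- Relabelling leaves a Horn rule alone, so surviving `without Hs` says that its pair
            -- `q` is not among `pairs Hs`.
            let ρ≈ = ≈ᴿ-trans e (relabel-cong {_∪ Gʰ Hs} {_∪ Gʰ Hs} (λ {X} {Y} → ∪-cong (Gʰ Hs) {X} {Y}) e′)
            in ∈-canon⁺ʳ (V ─ pairs Hs) (∈-─⁺ V _ q∈ (λ k → n (OneOf-resp Hs (≈ᴿ-sym ρ≈) (Anyₚ.map⁻ k)))) ρ≈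

          from : canon (V ─ pairs Hs) ⊆ᴿ ((C ⊕ Gʰ Hs) without Hs)
          from i with ∈-canon⁻ (V ─ pairs Hs) i
          ... | inj₁ (σ , j , e) = ∈-up⁺ C Hs (proj₂ C≈ (∈-canon⁺ˡ V j ≈ᴿ-refl))
            (≈ᴿ-trans e (≈ᴿ-sym (compose ≈ᴿ-refl ≈ᴿ-refl)))
            (NonHorn⇒¬OneOf Hs _ (NonHorn-resp (≈ᴿ-sym e) (NonHorn-relabel⁺ _ σ (nonHorn j))))
          ... | inj₂ (q , q∈ , e) =
            let (q∈V , q∉) = ∈-─⁻ V _ q∈
            in ∈-up⁺ C Hs {σ = horn (hornᵠ q)} (proj₂ C≈ (∈-canon⁺ʳ V q∈V ≈ᴿ-refl)) e (q∉ ∘ Anyₚ.map⁺ ∘ OneOf-resp Hs e)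

      -- Fracturing twice removes the union: on labels this is `∖-++`, and the Horn rules accumulate
      -- alongside.
      down-canon : ∀ Ps → (C ⊖ Gᴾ Ps) with′ Hᴾ Ps ≈ canon (V ++ Ps)
      down-canon Ps = to , from
        where
          compose : ∀ {ρ σ τ} → ρ ≈ᴿ σ ⊖ᴿ Gᴾ Ps → σ ≈ᴿ relabel (const (rest V)) τ →
                    ρ ≈ᴿ relabel (const (rest (V ++ Ps))) τ
          compose = relabel-rest (_∖ Gᴾ Ps) V (λ {X} {Y} → ∖-cong (Gᴾ Ps) {X} {Y})
            (∖-++ (⟦_⟧ ∘ firstRule) T V Ps)

          to : ((C ⊖ Gᴾ Ps) with′ Hᴾ Ps) ⊆ᴿ canon (V ++ Ps)
          to i with ∈-down⁻ C Ps i
          ... | inj₂ (q , q∈ , e) = ∈-canon⁺ʳ (V ++ Ps) (∈-++⁺ʳ V q∈) e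
          ... | inj₁ (σ , j , e) with ∈-canon⁻ V (proj₁ C≈ j)
          ...   | inj₁ (τ , k , e′)  = ∈-canon⁺ˡ (V ++ Ps) k (compose e e′)
          ...   | inj₂ (q , q∈ , e′) = ∈-canon⁺ʳ (V ++ Ps) (∈-++⁺ˡ q∈)
                  (≈ᴿ-trans e (relabel-cong {_∖ Gᴾ Ps} {_∖ Gᴾ Ps} (λ {X} {Y} → ∖-cong (Gᴾ Ps) {X} {Y}) e′))

          from : canon (V ++ Ps) ⊆ᴿ ((C ⊖ Gᴾ Ps) with′ Hᴾ Ps)
          from i with ∈-canon⁻ (V ++ Ps) i
          ... | inj₁ (τ , k , e) = ∈-down⁺ˡ C Ps (proj₂ C≈ (∈-canon⁺ˡ V k ≈ᴿ-refl))
                (≈ᴿ-trans e (≈ᴿ-sym (compose ≈ᴿ-refl ≈ᴿ-refl)))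
          ... | inj₂ (q , q∈ , e) with ∈-++⁻ V q∈
          ...   | inj₁ j = ∈-down⁺ˡ C Ps (proj₂ C≈ (∈-canon⁺ʳ V j ≈ᴿ-refl)) e
          ...   | inj₂ j = ∈-down⁺ʳ C Ps j e

    -- Closed sets of pairs, and both orders as reverse inclusion

    record Closed (V : List ProductionPair) : Set where
      field
        bounded  : V ⊆ P T
        -- The successors range over the fixed set `P T` rather than over the dependency graph of
        -- one calculus, so the condition can be carried along a sequence of moves.
        ⊏-closed : ∀ {p q} → p ∈ V → q ∈ P T → p ⊏ q → q ∈ V

    open Closed

    Canonical : Calculus → Set₁
    Canonical C = ∃[ V ] Closed V × C ≈ canon V

    module _ {C D : Calculus} {V W : List ProductionPair}
      (clV : Closed V) (clW : Closed W) (W⊆V : W ⊆ V) (C≈ : C ≈ canon V) (D≈ : D ≈ canon W) where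

      -- The Horn rules of `V ─ W` are absorbed, which leaves those of `W`. Their absorption is
      -- anti-fracturable because a path starting in the closed set `W` never leaves it.
      ⊇⇒⋜ : C ⋜ D
      ⊇⇒⋜ = Hᴾ (V ─ W) , (λ {h} → Hs⊆ {h}) , anti ,
        ≈-trans {D} {canon W} {(C ⊕ Gʰ Hs) without Hs} D≈
          (≈-trans {canon W} {canon (V ─ pairs Hs)} {(C ⊕ Gʰ Hs) without Hs}
            (canon-cong W (V ─ pairs Hs) W⊆ ⊆W)
            (≈-sym {(C ⊕ Gʰ Hs) without Hs} {canon (V ─ pairs Hs)}
              (up-canon V C≈ Hs (bounded clV ∘ proj₁ ∘ ∈-─⁻ V W ∘ ∈-pairs-Hᴾ⁻ (V ─ W)))))
        where
          Hs = Hᴾ (V ─ W)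

          ∈Hs⁻ : ∀ {h} → h ∈ʰ Hs → pairʰ h ∈ V × pairʰ h ∉ W
          ∈Hs⁻ = ∈-─⁻ V W ∘ Anyₚ.map⁻

          Hs⊆ : Hs ⊆ʰ H C
          Hs⊆ {h} i = H-canon⁺ V C≈ (proj₁ (∈Hs⁻ {h} i))

          ∉Hs⇒∈W : ∀ {q} → q ∈ V → q ∉ V ─ W → q ∈ W
          ∉Hs⇒∈W {q} i n with q ∈? W
          ... | yes j = j
          ... | no m  = ⊥-elim (n (∈-─⁺ V W i m))

          forwards : ∀ {p q} → p ⊑[ Gʰ (H C) ] q → p ∈ W → q ∈ W
          forwards ε i = i
          forwards (_◅_ {j = q} (_ , q∈ , p⊏q) path) i =
            forwards path (⊏-closed clW i (bounded clV (H-canon⁻ V C≈ {hornᵠ q} (∈-PGʰ⁻ (H C) q∈))) p⊏q)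

          anti : AntiFracturable (DGʰ (H C)) (_∈ʰ Hs)
          anti (v , v′ , v∈ , v′∈ , (_ , v∉) , v′-in , path) =
            v′-in (v′∈ , λ i → proj₂ (∈Hs⁻ {v′} i)
              (forwards path (∉Hs⇒∈W (H-canon⁻ V C≈ {v} v∈) (v∉ ∘ Anyₚ.map⁺))))

          W⊆ : W ⊆ V ─ pairs Hs
          W⊆ i = ∈-─⁺ V _ (W⊆V i) (λ j → proj₂ (∈-─⁻ V W (∈-pairs-Hᴾ⁻ (V ─ W) j)) i)

          ⊆W : V ─ pairs Hs ⊆ W
          ⊆W i = let (j , n) = ∈-─⁻ V _ i in ∉Hs⇒∈W j (n ∘ ∈-pairs-Hᴾ⁺ (V ─ W))

      -- The pairs of `V ─ W` are fractured out of `D`. A path from one of them stays in `V` because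
      -- `V` is closed, and avoids `W` because no node of the dependency graph of `N D` lies in `W`.
      ⊇⇒⩽ : C ⩽ D
      ⊇⇒⩽ = V ─ W , ⊆P , frac ,
        ≈-trans {C} {canon V} {(D ⊖ Gᴾ (V ─ W)) with′ Hᴾ (V ─ W)} C≈
          (≈-trans {canon V} {canon (W ++ (V ─ W))} {(D ⊖ Gᴾ (V ─ W)) with′ Hᴾ (V ─ W)}
            (canon-cong V (W ++ (V ─ W)) V⊆ ([ W⊆V , proj₁ ∘ ∈-─⁻ V W ]′ ∘ ∈-++⁻ W))
            (≈-sym {(D ⊖ Gᴾ (V ─ W)) with′ Hᴾ (V ─ W)} {canon (W ++ (V ─ W))} (down-canon W D≈ (V ─ W))))
        where
          ⊆P : V ─ W ⊆ P (N D)
          ⊆P i = let (j , n) = ∈-─⁻ V W i in PN-canon⁺ W D≈ (bounded clV j) n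

          forwards : ∀ {p q} → p ⊑[ N D ] q → p ∈ V ─ W → q ∈ V ─ W
          forwards ε                        i = i
          forwards ((_ , q∈ , p⊏q) ◅ path) i =
            let (q∈T , q∉W) = PN-canon⁻ W D≈ q∈
            in forwards path (∈-─⁺ V W (⊏-closed clV (proj₁ (∈-─⁻ V W i)) q∈T p⊏q) q∉W)

          frac : Fracturable (DG (N D)) (_∈ V ─ W)
          frac (_ , _ , _ , _ , v∈ , v′∉ , path) = v′∉ (forwards path v∈)

          V⊆ : V ⊆ W ++ (V ─ W)
          V⊆ {q} i with q ∈? W
          ... | yes j = ∈-++⁺ˡ j
          ... | no n  = ∈-++⁺ʳ W (∈-─⁺ V W i n)

    -- A successor of a remaining pair lies in `V` by closure. Were it absorbed, the path of length
    -- one leading to it would violate anti-fracturability.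
    up-step : ∀ {C D V} → Closed V → C ≈ canon V → C ⋜ D → ∃[ W ] Closed W × W ⊆ V × D ≈ canon W
    up-step {C} {D} {V} cl C≈ (Hs , Hs⊆ , anti , D≈) =
      V ─ pairs Hs ,
      record { bounded = bounded cl ∘ proj₁ ∘ ∈-─⁻ V _ ; ⊏-closed = fw } ,
      proj₁ ∘ ∈-─⁻ V _ ,
      ≈-trans {D} {(C ⊕ Gʰ Hs) without Hs} {canon (V ─ pairs Hs)} D≈ (up-canon V C≈ Hs pairs⊆)
      where
        pairs⊆ : pairs Hs ⊆ P T
        pairs⊆ {q} i = bounded cl (H-canon⁻ V C≈ {hornᵠ q} (Hs⊆ {hornᵠ q} (Anyₚ.map⁻ i)))

        fw : ∀ {p q} → p ∈ V ─ pairs Hs → q ∈ P T → p ⊏ q → q ∈ V ─ pairs Hs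
        fw {p} {q} p∈ q∈T p⊏q = ∈-─⁺ V _ q∈V λ i →
            anti (hornᵠ p , hornᵠ q , vp , vq , (vp , p∉ ∘ Anyₚ.map⁺) , (λ (_ , n) → n (Anyₚ.map⁻ i))
                 , (∈-PGʰ⁺ (H C) {hornᵠ p} vp , ∈-PGʰ⁺ (H C) {hornᵠ q} vq , p⊏q) ◅ ε)
          where
            p∉ = proj₂ (∈-─⁻ V _ p∈)
            p∈V = proj₁ (∈-─⁻ V _ p∈)
            q∈V = ⊏-closed cl p∈V q∈T p⊏q
            vp : hornᵠ p ∈ʰ H C
            vp = H-canon⁺ V C≈ p∈V
            vq : hornᵠ q ∈ʰ H C
            vq = H-canon⁺ V C≈ q∈V

    -- Successors of `W` stay in `W`. A successor of `Ps` outside `W` is still a node of the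
    -- dependency graph of `N D`, so fracturability forces it into `Ps`.
    down-step : ∀ {C D W} → Closed W → D ≈ canon W → C ⩽ D → ∃[ V ] Closed V × W ⊆ V × C ≈ canon V
    down-step {C} {D} {W} cl D≈ (Ps , Ps⊆ , frac , C≈) =
      W ++ Ps ,
      record { bounded = [ bounded cl , proj₁ ∘ PN-canon⁻ W D≈ ∘ Ps⊆ ]′ ∘ ∈-++⁻ W ; ⊏-closed = fw } ,
      ∈-++⁺ˡ ,
      ≈-trans {C} {(D ⊖ Gᴾ Ps) with′ Hᴾ Ps} {canon (W ++ Ps)} C≈ (down-canon W D≈ Ps)
      where
        fw : ∀ {p q} → p ∈ W ++ Ps → q ∈ P T → p ⊏ q → q ∈ W ++ Ps
        -- `frac` only refutes that `q` lies outside; deciding membership makes this positive.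
        fw {p} {q} p∈ q∈T p⊏q with q ∈? W ++ Ps | ∈-++⁻ W p∈
        ... | yes i | _      = i
        ... | no n  | inj₁ i = ∈-++⁺ˡ (⊏-closed cl i q∈T p⊏q)
        ... | no n  | inj₂ i = ⊥-elim (frac (p , q , Ps⊆ i , q∈ , i , n ∘ ∈-++⁺ʳ W , (Ps⊆ i , q∈ , p⊏q) ◅ ε))
          where
            q∈ : q ∈ P (N D)
            q∈ = PN-canon⁺ W D≈ q∈T (n ∘ ∈-++⁺ˡ)

    -- Both orders pass through the inclusion `W ⊆ V`. The canonical form of the calculus reached is
    -- produced by the step itself.
    ⋜⇒⩽ : ∀ {C D} → Canonical C → C ⋜ D → C ⩽ D
    ⋜⇒⩽ (V , cl , C≈) le = let (W , clW , W⊆V , D≈) = up-step cl C≈ le in ⊇⇒⩽ cl clW W⊆V C≈ D≈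

    ⩽⇒⋜ : ∀ {C D} → Canonical D → C ⩽ D → C ⋜ D
    ⩽⇒⋜ (W , cl , D≈) le = let (V , clV , W⊆V , C≈) = down-step cl D≈ le in ⊇⇒⋜ clV cl W⊆V C≈ D≈

    -- Both spaces consist of the canonical calculi

    UpSpace⇒Canonical : ∀ {A C} → Canonical A → UpSpace A C → Canonical C
    UpSpace⇒Canonical {A} {C} (V , cl , A≈) (start C≈A) = V , cl , ≈-trans {C} {A} {canon V} C≈A A≈
    UpSpace⇒Canonical can (step up le) =
      let (_ , cl , C≈) = UpSpace⇒Canonical can up ; (W , clW , _ , D≈) = up-step cl C≈ le in W , clW , D≈

    DownSpace⇒Canonical : ∀ {B C} → Canonical B → DownSpace B C → Canonical C
    DownSpace⇒Canonical {B} {C} (V , cl , B≈) (start C≈B) = V , cl , ≈-trans {C} {B} {canon V} C≈B B≈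
    DownSpace⇒Canonical can (step down le) =
      let (_ , cl , D≈) = DownSpace⇒Canonical can down ; (V , clV , _ , C≈) = down-step cl D≈ le in V , clV , C≈

    closed-P : Closed (P T)
    closed-P = record { bounded = id ; ⊏-closed = λ _ q∈ _ → q∈ }

    closed-[] : Closed []
    closed-[] = record { bounded = λ () ; ⊏-closed = λ () }

    -- Every closed `V` lies between `[]` and `P T`, so a canonical calculus is a single move away
    -- from `A` and a single move away from `B`. The isomorphism is the identity on calculi.
    conclusion : ∀ A B → A ≈ canon (P T) → B ≈ canon [] → Coincide A B
    conclusion A B A≈ B≈ = (up⇒down , down⇒up) , (identity , isomorphism) , same-grammar
      where
        fromUp : ∀ {C} → UpSpace A C → Canonical C
        fromUp = UpSpace⇒Canonical (P T , closed-P , A≈)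

        fromDown : ∀ {C} → DownSpace B C → Canonical C
        fromDown = DownSpace⇒Canonical ([] , closed-[] , B≈)

        up⇒down : ∀ {C} → UpSpace A C → DownSpace B C
        up⇒down up = let (V , cl , C≈) = fromUp up in
          step (start (≈-refl {B})) (⊇⇒⩽ cl closed-[] (λ ()) C≈ B≈)

        down⇒up : ∀ {C} → DownSpace B C → UpSpace A C
        down⇒up down = let (V , cl , C≈) = fromDown down in
          step (start (≈-refl {A})) (⊇⇒⋜ closed-P cl (bounded cl) A≈ C≈)

        identity : ∃ (UpSpace A) → ∃ (DownSpace B)
        identity (C , up) = C , up⇒down up

        isomorphism : IsOrderIsomorphism
          (Poset._≈_ (Up A)) (Poset._≈_ (Down B)) (Poset._≤_ (Up A)) (Poset._≤_ (Down B)) identity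
        isomorphism = record
          { isOrderMonomorphism = record
            { isOrderHomomorphism = record
              { cong = id
              ; mono = λ {(_ , up)} → ⋜⇒⩽ (fromUp up)
              }
            ; injective = id
            ; cancel    = λ {_} {(_ , up)} → ⩽⇒⋜ (fromUp up)
            }
          ; surjective = λ (C , down) → (C , down⇒up down) , id
          }

        same-grammar : ∀ C D → UpSpace A C → UpSpace A D → G C ≈ᴳ G D
        same-grammar C D c d =
          let (V , clV , C≈) = fromUp c ; (W , clW , D≈) = fromUp d
          in ≈ᴳ-trans {G C} {T} {G D} (G-canon V C≈ (bounded clV)) (≈ᴳ-sym {G D} {T} (G-canon W D≈ (bounded clW)))

  -- Edge labels of explicit and implicit calculi

  initialOrReach : ∀ ρ {X} → X ∈ participating ρ → InitialOrReach ρ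
  initialOrReach (initial _ _) _ = isInitial
  initialOrReach (reach _ _)   _ = isReach

  ∈-Gᴿ⇒InitialOrReach : ∀ ρ → NonHorn ρ → ∀ {p} → p ∈ᴳ Gᴿ ρ → InitialOrReach ρ
  ∈-Gᴿ⇒InitialOrReach (initial _ _) _ _ = isInitial
  ∈-Gᴿ⇒InitialOrReach (reach _ _)   _ _ = isReach

  -- A production on an edge belongs to `G A`, so fracturing by `G A` would remove it from a rule
  -- that explicitness keeps unchanged.
  explicit⇒N-empty : ∀ A → Explicit A → ∀ {p} → p ∉ᴳ N A
  explicit⇒N-empty A ex p∈ =
    let (ρ , i , n , p∈ρ) = ∈-N⁻ A p∈
        (σ , σ∈ , e)      = find i
        nσ  = NonHorn-resp e n
        p∈σ = Gᴿ-cong e p∈ρ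
        fixed = All.lookup ex σ∈ (∈-Gᴿ⇒InitialOrReach σ nσ p∈σ)
    in proj₂ (Gᴿ-⊖⁻ σ (G A) nσ (Gᴿ-cong (≈ᴿ-sym fixed) p∈σ)) (∈-G⁺ i p∈ρ)

  -- Absorbing `G B` changes no label, so `G B`, and with it `N B`, is contained in `X`; conversely
  -- `N B` collects all labels.
  implicit⇒uniform : ∀ B → Implicit B → ∀ {ρ X} → ρ ∈ᴿ B → NonHorn ρ → X ∈ participating ρ → X ≈ᴳ N B
  implicit⇒uniform B (noHorn , im) {ρ} {X} i n X∈ = mk⇔
    (participating⊆N i n X∈)
    (λ p∈ → ⇔.to X∪G≈X (∈-++⁺ʳ (rules X) (N⊆G B p∈)))
    where
      -- `im` speaks of listed rules, while `ρ` is one only up to `≈ᴿ`; the property is transported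
      -- from the listed representative `σ`.
      fixed : ρ ⊕ᴿ G B ≈ᴿ ρ
      fixed = let (σ , σ∈ , e) = find i in
        ≈ᴿ-trans (relabel-cong {_∪ G B} {_∪ G B} (λ {X} {Y} → ∪-cong (G B) {X} {Y}) e)
          (≈ᴿ-trans (All.lookup im σ∈ (resp e (initialOrReach ρ X∈))) (≈ᴿ-sym e))
        where
          resp : ∀ {ρ σ} → ρ ≈ᴿ σ → InitialOrReach ρ → InitialOrReach σ
          resp (initial _ _) _ = isInitial
          resp (reach _ _)   _ = isReach
      X∪G≈X : X ∪ G B ≈ᴳ X
      X∪G≈X = All.lookup (relabel-fixed⁻ (_∪ G B) ρ fixed) X∈

  ∈-hornFree⁻ : ∀ A {ρ} → ρ ∈ᴿ A without H A → ρ ∈ᴿ A × NonHorn ρ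
  ∈-hornFree⁻ A {ρ} i = let (j , n) = ∈-without⁻ (H A) i in j , ¬OneOf⇒NonHorn ρ j n

  ∈-hornFree⁺ : ∀ A {ρ} → ρ ∈ᴿ A → NonHorn ρ → ρ ∈ᴿ A without H A
  ∈-hornFree⁺ A {ρ} i n = ∈-without⁺ (H A) i (NonHorn⇒¬OneOf (H A) ρ n)

  -- Explicit and implicit calculi in canonical form

  module HornFreePart (T : ESystem) (A : Calculus)
    (edged : ∀ {p} → p ∈ᴳ T → ∃[ ρ ] ρ ∈ᴿ A without H A × participating ρ ≢ []) where

    open Skeleton T (A without H A) (λ {ρ} → proj₂ ∘ ∈-hornFree⁻ A {ρ}) edged public

    -- Overwriting labels that already equal `rest V` changes nothing, so the Horn-free part of `A`
    -- serves as its own skeleton.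
    uniform⇒canon : ∀ V → (∀ {ρ X} → ρ ∈ᴿ A → NonHorn ρ → X ∈ participating ρ → rest V ≈ᴳ X) →
                    pairs (H A) ⊆ V → V ⊆ pairs (H A) → A ≈ canon V
    uniform⇒canon V uniform H⊆V V⊆H = to , from
      where
        fixed : ∀ {ρ} → ρ ∈ᴿ A → NonHorn ρ → relabel (const (rest V)) ρ ≈ᴿ ρ
        fixed {ρ} i n = relabel-fixed (const (rest V)) ρ (All.tabulate (λ {X} → uniform {ρ} {X} i n))

        to : A ⊆ᴿ canon V
        to {ρ} i with rule-cases ρ
        ... | inj₁ n          = ∈-canon⁺ˡ V (∈-hornFree⁺ A i n) (≈ᴿ-sym (fixed i n))
        ... | inj₂ (h , refl) = ∈-canon⁺ʳ V (H⊆V (Anyₚ.map⁺ (∈-H⁺ i))) (horn refl)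

        from : canon V ⊆ᴿ A
        from i with ∈-canon⁻ V i
        ... | inj₁ (σ , j , e) = let (k , n) = ∈-hornFree⁻ A j in ∈ᴿ-resp (≈ᴿ-sym (≈ᴿ-trans e (fixed k n))) k
        ... | inj₂ (q , j , e) = ∈ᴿ-resp (≈ᴿ-sym e) (∈-H⁻ {A} {hornᵠ q} (Anyₚ.map⁻ (V⊆H j)))

  participating⇒NonHorn : ∀ ρ → participating ρ ≢ [] → NonHorn ρ
  participating⇒NonHorn (initial _ _)   _ = refl
  participating⇒NonHorn (reach _ _)     _ = refl
  participating⇒NonHorn (local _)       _ = refl
  participating⇒NonHorn (expansion _ _) _ = refl
  participating⇒NonHorn (horn _)        n = contradiction refl n

  -- A production in `Gʰ (H A)` shows that `H A` is non-empty, which triggers `AbsorbsHorn`.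
  explicit-edged : ∀ A → AbsorbsHorn A → ∀ {p} → p ∈ᴳ Gʰ (H A) →
                   ∃[ ρ ] ρ ∈ᴿ A without H A × participating ρ ≢ []
  explicit-edged A absorbs {p} p∈ =
    let (ρ , ρ∈ , n) = find (absorbs λ eq → nonempty (subst (λ Hs → p ∈ᴳ Gʰ Hs) eq p∈))
    in ρ , ∈-hornFree⁺ A (Any.map ≡⇒≈ᴿ ρ∈) (participating⇒NonHorn ρ n) , n
    where
      nonempty : p ∉ᴳ Gʰ []
      nonempty ()

  N-edged : ∀ B {p} → p ∈ᴳ N B → ∃[ ρ ] ρ ∈ᴿ B without H B × participating ρ ≢ []
  N-edged B {p} p∈ =
    let (ρ , i , n , p∈ρ) = ∈-N⁻ B p∈
        p∈⋃ = subst (p ∈ᴳ_) (Gᴿ-NonHorn ρ n) p∈ρ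
    in ρ , ∈-hornFree⁺ B i n , λ eq → nonempty (subst (λ Xs → p ∈ᴳ ⋃ Xs) eq p∈⋃)
    where
      nonempty : p ∉ᴳ ∅
      nonempty ()

  implicit-without-horn : ∀ B → Implicit B → ∀ {h} → h ∉ʰ H B
  implicit-without-horn B (H≡[] , _) {h} i = nonempty (subst (h ∈ʰ_) H≡[] i)
    where
      nonempty : h ∉ʰ []
      nonempty ()

  -- The two cases of the hypothesis

  upward-coincide : ∀ A B → Explicit A → Implicit B → AbsorbsHorn A → UpSpace A B → Coincide A B
  upward-coincide A B ex im absorbs up =
    -- `H-canon⁺` turns each member of `W` into a Horn rule of `B`, which has none; so `W` is empty.
    let (W , _ , B≈) = UpSpace⇒Canonical (P T , closed-P , A≈) up
    in conclusion A B A≈ (≈-trans {B} {canon W} {canon []} B≈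
         (canon-cong W [] (λ {q} → ⊥-elim ∘ implicit-without-horn B im {hornᵠ q} ∘ H-canon⁺ W B≈) λ ()))
    where
      -- This is `G A` up to `≈ᴳ`, because explicitness makes `N A` empty.
      T = Gʰ (H A)
      open HornFreePart T A (explicit-edged A absorbs)

      A≈ : A ≈ canon (P T)
      A≈ = uniform⇒canon (P T)
        -- Both inclusions are vacuous: `rest (P T)` has nothing left, and the labels of `A` are
        -- empty.
        (λ i n X∈ → mk⇔
          (λ p∈ → let (j , m) = ∈-rest⁻ (P T) p∈ in ⊥-elim (m (∈-P⁺ T j)))
          (λ p∈ → ⊥-elim (explicit⇒N-empty A ex (participating⊆N {A} i n X∈ p∈))))
        (λ {q} i → ∈-PGʰ⁺ (H A) {hornᵠ q} (Anyₚ.map⁻ i))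
        (λ i → Anyₚ.map⁺ (∈-PGʰ⁻ (H A) i))

  downward-coincide : ∀ A B → Explicit A → Implicit B → DownSpace B A → Coincide A B
  downward-coincide A B ex im down =
    let (W , cl , A≈) = DownSpace⇒Canonical ([] , closed-[] , B≈) down
    in conclusion A B (≈-trans {A} {canon W} {canon (P T)} A≈
         (canon-cong W (P T) (Closed.bounded cl) (P⊆ A≈))) B≈
    where
      -- This is `G B` up to `≈ᴳ`, because `B` has no Horn rules.
      T = N B
      open HornFreePart T B (N-edged B)

      B≈ : B ≈ canon []
      B≈ = uniform⇒canon []
        (λ {_} {X} i n X∈ → ≈ᴳ-trans {rest []} {T} {X} (∖-identityʳ T)
          (≈ᴳ-sym {X} {T} (implicit⇒uniform B im i n X∈)))
        (λ {q} i → ⊥-elim (implicit-without-horn B im {hornᵠ q} (Anyₚ.map⁻ i)))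
        (λ ())

      -- A pair of `T` missing from `W` would show up on an edge of the explicit calculus `A`.
      P⊆ : ∀ {W} → A ≈ canon W → P T ⊆ W
      P⊆ {W} A≈ {q} i with q ∈? W
      ... | yes j = j
      ... | no n  = ⊥-elim (explicit⇒N-empty A ex (N-canon⁺ W A≈ (∈-P⁻ T (firstRule q) i) n))

mainTheorem19 : (sig : Signature) → let open Calculi sig in
    (A B : Calculus) →
    Explicit A →
    Implicit B →
    AbsorbsHorn A →
    UpSpace A B ⊎ DownSpace B A →
    UpSpace A ≐ DownSpace B
    × ∃ (IsOrderIsomorphism (Poset._≈_ (Up A)) (Poset._≈_ (Down B)) (Poset._≤_ (Up A)) (Poset._≤_ (Down B)))
    × (∀ C D → UpSpace A C → UpSpace A D → G C ≈ᴳ G D)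
mainTheorem19 sig A B ex im absorbs =
  [ upward-coincide sig A B ex im absorbs , downward-coincide sig A B ex im ]′
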